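{- Let $S=\langle a_1,\dots,a_k\rangle\subset\mathbb{Z}_{\ge 0}$ be a numerical monoid with $a_i\neq 0$ for all $i$, let $j\in\{1,\dots,k\}$, and let $\prec_j$ be an Apéry ordering with respect to $a_j$ on $\mathbb{Q}[x,y_1,\dots,y_k]$. Then $$\Delta_{\prec_j}(S,a_j)=Ap(S,a_j).$$
   Context: A numerical monoid is a set $S=\langle a_1,\dots,a_k\rangle=\{\lambda_1a_1+\dots+\lambda_ka_k\mid \lambda_i\in\mathbb{Z}_{\ge 0}\}$ with $a_i\in\mathbb{Z}_{\geq 0}$ and $\gcd(a_1,\dots,a_k)=1$. Apéry set: for $s\in S$, $s\ne 0$, $Ap(S,s)=\{0,w_1,\dots,w_{s-1}\}$, where $w_i$ is the smallest element of $S$ congruent to $i$ modulo $s$; equivalently $Ap(S,s)=\{x\in S\mid x-s\notin S\}$. Ideal: $I_S=\langle y_1-x^{a_1},\dots,y_k-x^{a_k}\rangle\subset\mathbb{Q}[x,y_1,\dots,y_k]$. Exponents: for a monomial ordering $\prec$ and a nonzero polynomial $g=\sum a_{\underline\alpha}x^{\alpha_0}y_1^{\alpha_1}\cdots y_k^{\alpha_k}$, $\exp(g)=\max_\prec\{\underline\alpha\mid a_{\underline\alpha}\ne 0\}\in\mathbb{Z}_{\ge 0}^{k+1}$. Apéry ordering with respect to $a_j$: a monomial ordering $\prec_j$ on $\mathbb{Q}[x,y_1,\dots,y_k]$ which compares two monomials $x^{\alpha_0}y_1^{\alpha_1}\cdots y_k^{\alpha_k}$ by the following criteria, in succession (each used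 only to break ties in the previous ones; larger value means larger monomial): (1) the exponent $\alpha_0$ of $x$; (2) the weight $\sum_{i\ne j}\alpha_ia_i$; (3) an arbitrary (chosen) monomial ordering on the variables $y_i$, $i\neq j$; (4) the exponent $\alpha_j$ of $y_j$. Let $\mathcal{B}_j=\{g_1,\dots,g_r\}$ be the reduced Groebner basis of $I_S$ with respect to $\prec_j$, let $N_j$ denote the normal form with respect to $\mathcal{B}_j$ (the normal form of a monomial is again a monomial), and put $E(I_S)=\bigcup_{i=1}^r\left(\exp(g_i)+\mathbb{Z}_{\ge 0}^{k+1}\right)$, $\overline{E(I_S)}=\mathbb{Z}_{\ge 0}^{k+1}\setminus E(I_S)$. The coordinates on $\mathbb{Z}^{k+1}_{\geq 0}$ are named after the variables, so $\{x=y_j=0\}$ is the set of exponents whose $x$- and $y_j$-coordinates are zero. Define $$\Delta_{\prec_j}(S,a_j)=\left\{N\in\mathbb{Z}_{\ge 0}\mid \exp\left(N_j(x^N)\right)\in\{x=y_j=0\}\cap\overline{E(I_S)}\right\}.$$ -}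

module Defs where

open import Data.Nat.Base as ℕ using (ℕ; suc; _<_; _≤_; ∣_-_∣)
open import Data.Nat.Divisibility using (_∣_)
open import Data.Nat.GCD using (gcd)
open import Data.Nat.Properties using (_≟_)
open import Data.Fin.Base using (Fin; zero; suc)
open import Data.List.Base as List using (List; []; _∷_; _++_; cartesianProductWith)
open import Data.Product.Base using (_×_; _,_; ∃-syntax)
open import Data.Product.Relation.Binary.Lex.Strict using (×-Lex)
open import Data.Rational.Base as ℚ using (ℚ; 0ℚ; 1ℚ)
open import Data.Sum.Base using (_⊎_)
open import Data.Vec.Base as Vec
  using (Vec; []; _∷_; lookup; removeAt; replicate; zipWith; tabulate; _[_]≔_)
open import Data.Vec.Properties using (≡-dec)
open import Function.Base using (_on_)
open import Function.Bundles using (_⇔_)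
open import Induction.WellFounded using (WellFounded)
open import Level using (0ℓ)
open import Relation.Binary.Core using (Rel)
open import Relation.Binary.PropositionalEquality.Core using (_≡_; _≢_)
open import Relation.Binary.Structures using (IsStrictTotalOrder)
open import Relation.Nullary using (¬_; yes; no)
open import Relation.Unary using (Pred; _∈_; _∉_)

weighted : ∀ {k} → Vec ℕ k → Vec ℕ k → ℕ
weighted a l = Vec.sum (zipWith ℕ._*_ l a)

⟨_⟩ : ∀ {k} → Vec ℕ k → Pred ℕ 0ℓ
⟨ a ⟩ n = ∃[ l ] n ≡ weighted a l

GcdOne : ∀ {k} → Vec ℕ k → Set
GcdOne a = Vec.foldr′ gcd 0 a ≡ 1

_≡_[mod_] : ℕ → ℕ → ℕ → Set
m ≡ n [mod s ] = s ∣ ∣ m - n ∣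

record IsLeastCongruent (S : Pred ℕ 0ℓ) (s i w : ℕ) : Set where
  field
    member    : w ∈ S
    congruent : w ≡ i [mod s ]
    least     : ∀ v → v ∈ S → v ≡ i [mod s ] → w ≤ v

Ap : Pred ℕ 0ℓ → ℕ → Pred ℕ 0ℓ
Ap S s w = w ≡ 0 ⊎ (∃[ i ] 0 < i × i < s × IsLeastCongruent S s i w)

Exponent : ℕ → Set
Exponent n = Vec ℕ n

_⊕_ : ∀ {n} → Exponent n → Exponent n → Exponent n
_⊕_ = zipWith ℕ._+_

-- A polynomial is a formal sum of terms, in which exponents may repeat and
-- coefficients may vanish. Only `coeff` is meaningful, so polynomials are
-- compared by _≈_ and never by _≡_.

Poly : ℕ → Set
Poly n = List (ℚ × Exponent n)

coeff : ∀ {n} → Poly n → Exponent n → ℚ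
coeff []            α = 0ℚ
coeff ((c , β) ∷ p) α with ≡-dec _≟_ β α
... | yes _ = c ℚ.+ coeff p α
... | no  _ = coeff p α

infix 4 _≈_ _∈supp_
infixl 6 _+ᴾ_ _-ᴾ_
infixl 7 _*ᴾ_

_≈_ : ∀ {n} → Poly n → Poly n → Set
p ≈ q = ∀ α → coeff p α ≡ coeff q α

_∈supp_ : ∀ {n} → Exponent n → Poly n → Set
α ∈supp p = coeff p α ≢ 0ℚ

monomial : ∀ {n} → Exponent n → Poly n
monomial α = (1ℚ , α) ∷ []

_+ᴾ_ : ∀ {n} → Poly n → Poly n → Poly n
_+ᴾ_ = _++_

_-ᴾ_ : ∀ {n} → Poly n → Poly n → Poly n
p -ᴾ q = p ++ List.map (λ (c , α) → ℚ.- c , α) q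

_*ᴾ_ : ∀ {n} → Poly n → Poly n → Poly n
_*ᴾ_ = cartesianProductWith (λ (c , α) (d , β) → c ℚ.* d , α ⊕ β)

combination : ∀ {n r} → Vec (Poly n) r → Vec (Poly n) r → Poly n
combination h f = Vec.foldr′ _+ᴾ_ [] (zipWith _*ᴾ_ h f)

Ideal : ∀ {n r} → Vec (Poly n) r → Pred (Poly n) 0ℓ
Ideal f p = ∃[ h ] p ≈ combination h f

record MonomialOrdering (n : ℕ) : Set₁ where
  infix 4 _≺_ _≼_
  field
    _≺_                : Rel (Exponent n) 0ℓ
    isStrictTotalOrder : IsStrictTotalOrder _≡_ _≺_
    wellFounded        : WellFounded _≺_
    ⊕-monoˡ            : ∀ γ {α β} → α ≺ β → (α ⊕ γ) ≺ (β ⊕ γ)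

  _≼_ : Rel (Exponent n) 0ℓ
  α ≼ β = α ≺ β ⊎ α ≡ β

-- IsExp ≺ g α says exp(g) = α; a relation, since exp(0) is undefined.

record IsExp {n} (≺ : MonomialOrdering n) (g : Poly n) (α : Exponent n) : Set where
  open MonomialOrdering ≺ using (_≼_)
  field
    inSupport : α ∈supp g
    maximal   : ∀ β → β ∈supp g → β ≼ α

E : ∀ {n r} → MonomialOrdering n → Vec (Poly n) r → Pred (Exponent n) 0ℓ
E ≺ G α = ∃[ i ] ∃[ γ ] ∃[ δ ] IsExp ≺ (lookup G i) γ × α ≡ γ ⊕ δ

record IsGroebnerBasis {n r} (≺ : MonomialOrdering n) (I : Pred (Poly n) 0ℓ)
                       (G : Vec (Poly n) r) : Set where
  field
    subset   : ∀ i → lookup G i ∈ I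
    nonzero  : ∀ i → ¬ (lookup G i ≈ [])
    covering : ∀ f → f ∈ I → ∀ α → IsExp ≺ f α → α ∈ E ≺ G

record IsReducedGroebnerBasis {n r} (≺ : MonomialOrdering n) (I : Pred (Poly n) 0ℓ)
                              (G : Vec (Poly n) r) : Set where
  field
    isGroebnerBasis : IsGroebnerBasis ≺ I G
    monic           : ∀ i α → IsExp ≺ (lookup G i) α → coeff (lookup G i) α ≡ 1ℚ
    reduced         : ∀ i j → i ≢ j → ∀ α γ δ → α ∈supp lookup G i →
                      IsExp ≺ (lookup G j) γ → α ≢ γ ⊕ δ

-- r is a remainder of f on division by G, in the sense of the division
-- theorem: f = q₁g₁ + … + qₛgₛ + r, where no monomial of r lies in E and
-- exp(qᵢgᵢ) ≼ exp(f) whenever qᵢgᵢ ≠ 0. When G is a Gröbner basis, r is unique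
-- up to _≈_ and is the normal form of f.

record IsNormalForm {n s} (≺ : MonomialOrdering n) (G : Vec (Poly n) s)
                    (f r : Poly n) : Set where
  open MonomialOrdering ≺ using (_≼_)
  field
    quotients : Vec (Poly n) s
    division  : f ≈ combination quotients G +ᴾ r
    bounded   : ∀ i β → IsExp ≺ (lookup quotients i *ᴾ lookup G i) β →
                ∃[ γ ] IsExp ≺ f γ × β ≼ γ
    standard  : ∀ α → α ∈supp r → α ∉ E ≺ G

-- In ℚ[x,y₁,…,yₖ], coordinate zero of an exponent is that of x, and
-- coordinate suc i is that of the variable y paired with the i-th generator.

x^_ : ∀ {k} → ℕ → Poly (suc k)
x^ N = monomial (N ∷ replicate _ 0)

y : ∀ {k} → Fin k → Poly (suc k)
y i = monomial (replicate _ 0 [ suc i ]≔ 1)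

I-generators : ∀ {k} → Vec ℕ k → Vec (Poly (suc k)) k
I-generators a = tabulate λ i → y i -ᴾ x^ (lookup a i)

I : ∀ {k} → Vec ℕ k → Pred (Poly (suc k)) 0ℓ
I a = Ideal (I-generators a)

-- Comparison by the exponent of x, then the weight Σ_{i≠j} αᵢaᵢ, then a
-- monomial ordering on the variables yᵢ (i ≠ j), then the exponent of yⱼ.

AperyCompare : ∀ {m} → Vec ℕ (suc m) → Fin (suc m) → MonomialOrdering m →
               Rel (Exponent (2 ℕ.+ m)) 0ℓ
AperyCompare {m} a j ≺ʸ =
  ×-Lex _≡_ _<_ (×-Lex _≡_ _<_ (×-Lex _≡_ _≺_ _<_)) on key
  where
  open MonomialOrdering ≺ʸ using (_≺_)

  key : Exponent (2 ℕ.+ m) → ℕ × ℕ × Exponent m × ℕ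
  key (α₀ ∷ α) =
    α₀ , weighted (removeAt a j) (removeAt α j) , removeAt α j , lookup α j

record IsAperyOrdering {m} (a : Vec ℕ (suc m)) (j : Fin (suc m))
                       (≺ⱼ : MonomialOrdering (2 ℕ.+ m)) : Set₁ where
  open MonomialOrdering ≺ⱼ using (_≺_)
  field
    ≺ʸ         : MonomialOrdering m
    comparison : ∀ α β → α ≺ β ⇔ AperyCompare a j ≺ʸ α β

-- The natural numbers N such that exp(N_j(x^N)) lies in {x = y_j = 0} but not in E, where N_j
-- is the normal form with respect to B.

Δ : ∀ {k r} → MonomialOrdering (suc k) → Fin k → Vec (Poly (suc k)) r → Pred ℕ 0ℓ
Δ ≺ j B N = ∃[ f ] ∃[ α ] IsNormalForm ≺ B (x^ N) f × IsExp ≺ f α ×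
            lookup α zero ≡ 0 × lookup α (suc j) ≡ 0 × α ∉ E ≺ B

{-
A functional φ ∘ degree, where degree gives x weight 1 and yᵢ weight aᵢ, vanishes on I_S; hence
every polynomial of I_S has, next to any monomial, a second one of the same degree. Conversely
the difference of two monomials of equal degree lies in I_S. So the monomials outside E(I_S) are
exactly the smallest of their degrees, and N_j(x^N) is the smallest monomial of degree N. For an
Apéry ordering it is free of x iff N ∈ S, and then involves y_j iff N − a_j ∈ S, because moving
weight into y_j makes a monomial smaller. Both conditions together say N ∈ S and N − a_j ∉ S.
-}

module Submission where

open import Defs
open import Data.Bool.Base using (if_then_else_)
open import Data.Fin.Base using (Fin; zero; suc)
import Data.Fin.Properties as Fin
open import Data.List.Base as List using (List; []; _∷_; _++_; length; filter)
open import Data.List.Membership.Propositional using (find; lose) renaming (_∈_ to _∈ᴸ_)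
open import Data.List.Properties
  using (length-filter; ++-identityʳ; cartesianProductWith-zeroʳ; cartesianProductWith-distribʳ-++)
open import Data.List.Relation.Unary.Any using (here; there; any?)
open import Data.Nat.Base as ℕ using (ℕ; zero; suc; _+_; _≤_; _<_; z≤n; s≤s)
import Data.Nat.Divisibility as ∣
open import Data.Nat.DivMod using (_/_; _%_; m≡m%n+[m/n]*n; m%n<n)
import Data.Nat.Properties as ℕ
open import Data.Nat.Solver renaming (module +-*-Solver to ℕ-Solver)
open import Data.Product.Base using (_×_; _,_; proj₁; proj₂; ∃; ∃-syntax)
open import Data.Rational.Base as ℚ using (ℚ; 0ℚ; 1ℚ)
import Data.Rational.Properties as ℚ
open import Data.Rational.Solver using (module +-*-Solver)
open import Data.Sum.Base using (_⊎_; inj₁; inj₂)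
open import Data.Vec.Base as Vec
  using (Vec; []; _∷_; lookup; removeAt; replicate; zipWith; _[_]≔_)
import Data.Vec.Properties as Vec
open import Function.Base using (_∘_; flip)
open import Function.Bundles using (module Equivalence)
open import Induction.WellFounded using (Acc; acc)
open import Level using (0ℓ)
open import Relation.Binary.Definitions using (tri<; tri≈; tri>)
open import Relation.Binary.PropositionalEquality
open import Relation.Binary.Structures using (IsStrictTotalOrder)
open import Relation.Nullary using (¬_; Dec; yes; no; does; ¬?; _×-dec_; contradiction)
open import Relation.Nullary.Decidable using (map′; decidable-stable)
open import Relation.Unary using (Pred; Decidable; _≐_; _∈_; _∉_)

open ≡-Reasoning
open ℕ-Solver using ()
  renaming (solve to ℕ-solve; _:=_ to _:=ℕ_; _:+_ to _:+ℕ_; _:*_ to _:*ℕ_; con to ℕ-con)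
open +-*-Solver using (solve; _:=_; _:+_; _:*_; :-_; con)

-- A formal sum may repeat exponents and carry cancelling terms, so facts about coefficients do not
-- pass to the tail of its list. Identities are therefore proved for the pairing Σ c φ(α) with an
-- arbitrary test function φ, where induction on lists works, and are then moved to coefficients.
--
-- `Δ` asks for a remainder together with quotients whose products stay below exp(x^N). Knowing the
-- smallest monomial m of degree N is thus not enough for membership: x^N - m has to be divided by
-- the basis with control over every product. Since each intermediate polynomial stays in the ideal,
-- that division leaves nothing over. In the other direction a remainder f is given, and f agrees
-- with x^N modulo the ideal, so the functional picking out any degree other than N vanishes on f.
--
-- `Ap` is given by least elements of residue classes. The comparison with monomials goes through w
-- ∈ S and w ≢ v + s for all v ∈ S, which expresses w - s ∉ S while avoiding truncated subtraction.

private
  variable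
    k m n r : ℕ

-- Arithmetic of exponents

infix 4 _≟ᵉ_ _≋_

_≟ᵉ_ : (α β : Exponent n) → Dec (α ≡ β)
_≟ᵉ_ = Vec.≡-dec ℕ._≟_

⊕-identityˡ : (α : Exponent n) → replicate n 0 ⊕ α ≡ α
⊕-identityˡ = Vec.zipWith-identityˡ ℕ.+-identityˡ

⊕-assoc : (α β γ : Exponent n) → (α ⊕ β) ⊕ γ ≡ α ⊕ (β ⊕ γ)
⊕-assoc = Vec.zipWith-assoc ℕ.+-assoc

⊕-comm : (α β : Exponent n) → α ⊕ β ≡ β ⊕ α
⊕-comm = Vec.zipWith-comm ℕ.+-comm

⊕-cancelˡ : (γ : Exponent n) {α β : Exponent n} → γ ⊕ α ≡ γ ⊕ β → α ≡ β
⊕-cancelˡ []      {[]}    {[]}    _  = refl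
⊕-cancelˡ (c ∷ γ) {a ∷ α} {b ∷ β} eq =
  cong₂ _∷_ (ℕ.+-cancelˡ-≡ c a b (Vec.∷-injectiveˡ eq)) (⊕-cancelˡ γ (Vec.∷-injectiveʳ eq))

-- Where γ does not divide α, the truncated difference fails to add back to α.

divides? : (γ α : Exponent n) → Dec (∃[ δ ] α ≡ γ ⊕ δ)
divides? γ α = map′ (zipWith ℕ._∸_ α γ ,_) (λ { (δ , refl) → cong (γ ⊕_) (sym (⊕-∸ γ δ)) })
                    (α ≟ᵉ γ ⊕ zipWith ℕ._∸_ α γ)
  where
  ⊕-∸ : (γ δ : Exponent n) → zipWith ℕ._∸_ (γ ⊕ δ) γ ≡ δ
  ⊕-∸ []      []      = refl
  ⊕-∸ (c ∷ γ) (d ∷ δ) = cong₂ _∷_ (ℕ.m+n∸m≡n c d) (⊕-∸ γ δ)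

-- Polynomials as linear functionals on functions of the exponent

-- Repeated exponents need not be merged here, so the laws of addition and multiplication follow
-- term by term.
eval : Poly n → (Exponent n → ℚ) → ℚ
eval []            φ = 0ℚ
eval ((c , α) ∷ p) φ = c ℚ.* φ α ℚ.+ eval p φ

_≋_ : Poly n → Poly n → Set
p ≋ q = ∀ φ → eval p φ ≡ eval q φ

indicator : {P : Set} → Dec P → ℚ
indicator d = if does d then 1ℚ else 0ℚ

indicator-yes : {P : Set} (d : Dec P) → P → indicator d ≡ 1ℚ
indicator-yes (yes _) _ = refl
indicator-yes (no ¬p) p = contradiction p ¬p

indicator-no : {P : Set} (d : Dec P) → ¬ P → indicator d ≡ 0ℚ
indicator-no (yes p) ¬p = contradiction p ¬p
indicator-no (no _)  _  = refl

indicator-⇔ : {P Q : Set} (d : Dec P) (e : Dec Q) → (P → Q) → (Q → P) →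
              indicator d ≡ indicator e
indicator-⇔ (yes p) e f g = sym (indicator-yes e (f p))
indicator-⇔ (no ¬p) e f g = sym (indicator-no e (¬p ∘ g))

point : Exponent n → Exponent n → ℚ
point α β = indicator (β ≟ᵉ α)

coeff≡eval : (p : Poly n) (α : Exponent n) → coeff p α ≡ eval p (point α)
coeff≡eval []            α = refl
coeff≡eval ((c , β) ∷ p) α with β ≟ᵉ α
... | yes _ = cong₂ ℚ._+_ (sym (ℚ.*-identityʳ c)) (coeff≡eval p α)
... | no  _ = begin
  coeff p α                          ≡⟨ coeff≡eval p α ⟩
  eval p (point α)                   ≡⟨ solve 2 (λ c e → e := c :* con 0ℚ :+ e) refl c _ ⟩
  c ℚ.* 0ℚ ℚ.+ eval p (point α)      ∎

eval-cong : (p : Poly n) {φ ψ : Exponent n → ℚ} → (∀ α → φ α ≡ ψ α) → eval p φ ≡ eval p ψ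
eval-cong []            eq = refl
eval-cong ((c , α) ∷ p) eq = cong₂ (λ x y → c ℚ.* x ℚ.+ y) (eq α) (eval-cong p eq)

eval-0 : (p : Poly n) → eval p (λ _ → 0ℚ) ≡ 0ℚ
eval-0 []            = refl
eval-0 ((c , α) ∷ p) = cong₂ ℚ._+_ (ℚ.*-zeroʳ c) (eval-0 p)

eval-+ : (p : Poly n) (φ ψ : Exponent n → ℚ) →
         eval p (λ α → φ α ℚ.+ ψ α) ≡ eval p φ ℚ.+ eval p ψ
eval-+ []            φ ψ = refl
eval-+ ((c , α) ∷ p) φ ψ = begin
  c ℚ.* (φ α ℚ.+ ψ α) ℚ.+ eval p (λ α → φ α ℚ.+ ψ α)
    ≡⟨ cong (c ℚ.* (φ α ℚ.+ ψ α) ℚ.+_) (eval-+ p φ ψ) ⟩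
  c ℚ.* (φ α ℚ.+ ψ α) ℚ.+ (eval p φ ℚ.+ eval p ψ)
    ≡⟨ solve 5 (λ c x y u v → c :* (x :+ y) :+ (u :+ v) := c :* x :+ u :+ (c :* y :+ v))
               refl c (φ α) (ψ α) _ _ ⟩
  c ℚ.* φ α ℚ.+ eval p φ ℚ.+ (c ℚ.* ψ α ℚ.+ eval p ψ) ∎

eval-+ᴾ : (p q : Poly n) (φ : Exponent n → ℚ) → eval (p +ᴾ q) φ ≡ eval p φ ℚ.+ eval q φ
eval-+ᴾ []            q φ = sym (ℚ.+-identityˡ _)
eval-+ᴾ ((c , α) ∷ p) q φ =
  trans (cong (c ℚ.* φ α ℚ.+_) (eval-+ᴾ p q φ)) (sym (ℚ.+-assoc (c ℚ.* φ α) _ _))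

eval-neg : (p : Poly n) (φ : Exponent n → ℚ) →
           eval (List.map (λ (c , α) → ℚ.- c , α) p) φ ≡ ℚ.- eval p φ
eval-neg []            φ = refl
eval-neg ((c , α) ∷ p) φ = begin
  ℚ.- c ℚ.* φ α ℚ.+ eval (List.map _ p) φ ≡⟨ cong (ℚ.- c ℚ.* φ α ℚ.+_) (eval-neg p φ) ⟩
  ℚ.- c ℚ.* φ α ℚ.+ ℚ.- eval p φ
    ≡⟨ solve 3 (λ c x e → :- c :* x :+ :- e := :- (c :* x :+ e)) refl c (φ α) _ ⟩
  ℚ.- (c ℚ.* φ α ℚ.+ eval p φ) ∎

eval--ᴾ : (p q : Poly n) (φ : Exponent n → ℚ) → eval (p -ᴾ q) φ ≡ eval p φ ℚ.- eval q φ
eval--ᴾ p q φ = trans (eval-+ᴾ p _ φ) (cong (eval p φ ℚ.+_) (eval-neg q φ))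

eval-term : (c : ℚ) (γ : Exponent n) (q : Poly n) (φ : Exponent n → ℚ) →
            eval (List.map (λ (d , δ) → c ℚ.* d , γ ⊕ δ) q) φ ≡ c ℚ.* eval q (φ ∘ (γ ⊕_))
eval-term c γ []            φ = sym (ℚ.*-zeroʳ c)
eval-term c γ ((d , δ) ∷ q) φ = begin
  c ℚ.* d ℚ.* φ (γ ⊕ δ) ℚ.+ eval (List.map _ q) φ
    ≡⟨ cong (c ℚ.* d ℚ.* φ (γ ⊕ δ) ℚ.+_) (eval-term c γ q φ) ⟩
  c ℚ.* d ℚ.* φ (γ ⊕ δ) ℚ.+ c ℚ.* eval q (φ ∘ (γ ⊕_))
    ≡⟨ solve 4 (λ c d x e → c :* d :* x :+ c :* e := c :* (d :* x :+ e)) refl c d _ _ ⟩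
  c ℚ.* (d ℚ.* φ (γ ⊕ δ) ℚ.+ eval q (φ ∘ (γ ⊕_))) ∎

-- Multiplication is convolution: φ is paired along the sum γ ⊕ δ, first over q and then over p.
-- Laws of the product thereby reduce to laws of `_⊕_`.
eval-*ᴾ : (p q : Poly n) (φ : Exponent n → ℚ) →
          eval (p *ᴾ q) φ ≡ eval p (λ γ → eval q (φ ∘ (γ ⊕_)))
eval-*ᴾ []            q φ = refl
eval-*ᴾ ((c , γ) ∷ p) q φ =
  trans (eval-+ᴾ (List.map _ q) (p *ᴾ q) φ) (cong₂ ℚ._+_ (eval-term c γ q φ) (eval-*ᴾ p q φ))

-- Splitting off all terms with a given exponent

_without_ : Poly n → Exponent n → Poly n
p without α = filter (λ (_ , β) → ¬? (β ≟ᵉ α)) p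

coeff-without-≡ : (p : Poly n) (α : Exponent n) → coeff (p without α) α ≡ 0ℚ
coeff-without-≡ []            α = refl
coeff-without-≡ ((c , β) ∷ p) α with β ≟ᵉ α in eq
... | yes _ = coeff-without-≡ p α
... | no  _ rewrite eq = coeff-without-≡ p α

coeff-without-≢ : (p : Poly n) {α γ : Exponent n} → γ ≢ α → coeff (p without α) γ ≡ coeff p γ
coeff-without-≢ []            γ≢α = refl
coeff-without-≢ ((c , β) ∷ p) {α} {γ} γ≢α with β ≟ᵉ α | β ≟ᵉ γ in eq
... | yes β≡α | yes β≡γ = contradiction (trans (sym β≡γ) β≡α) γ≢α
... | yes _   | no  _   = coeff-without-≢ p γ≢α
... | no  _   | yes _ rewrite eq = cong (c ℚ.+_) (coeff-without-≢ p γ≢α)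
... | no  _   | no  _ rewrite eq = coeff-without-≢ p γ≢α

eval-without : (p : Poly n) (α : Exponent n) (φ : Exponent n → ℚ) →
               eval p φ ≡ coeff p α ℚ.* φ α ℚ.+ eval (p without α) φ
eval-without []            α φ = sym (trans (ℚ.+-identityʳ _) (ℚ.*-zeroˡ (φ α)))
eval-without ((c , β) ∷ p) α φ with β ≟ᵉ α
... | yes refl = begin
  c ℚ.* φ α ℚ.+ eval p φ ≡⟨ cong (c ℚ.* φ α ℚ.+_) (eval-without p α φ) ⟩
  c ℚ.* φ α ℚ.+ (coeff p α ℚ.* φ α ℚ.+ eval (p without α) φ)
    ≡⟨ solve 4 (λ c d x e → c :* x :+ (d :* x :+ e) := (c :+ d) :* x :+ e) refl c _ _ _ ⟩
  (c ℚ.+ coeff p α) ℚ.* φ α ℚ.+ eval (p without α) φ ∎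
... | no _ = begin
  c ℚ.* φ β ℚ.+ eval p φ ≡⟨ cong (c ℚ.* φ β ℚ.+_) (eval-without p α φ) ⟩
  c ℚ.* φ β ℚ.+ (coeff p α ℚ.* φ α ℚ.+ eval (p without α) φ)
    ≡⟨ solve 3 (λ x y z → x :+ (y :+ z) := y :+ (x :+ z)) refl
         (c ℚ.* φ β) (coeff p α ℚ.* φ α) (eval (p without α) φ) ⟩
  coeff p α ℚ.* φ α ℚ.+ (c ℚ.* φ β ℚ.+ eval (p without α) φ) ∎

without-vanishes : (p : Poly n) (α : Exponent n) (φ : Exponent n → ℚ) →
                   (∀ β → β ≢ α → coeff p β ℚ.* φ β ≡ 0ℚ) →
                   ∀ β → coeff (p without α) β ℚ.* φ β ≡ 0ℚ
without-vanishes p α φ p⊥φ β with β ≟ᵉ α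
... | yes refl = trans (cong (ℚ._* φ β) (coeff-without-≡ p α)) (ℚ.*-zeroˡ (φ β))
... | no β≢α   = trans (cong (ℚ._* φ β) (coeff-without-≢ p β≢α)) (p⊥φ β β≢α)

-- The hypothesis does not pass to the tail, since the head may cancel against later terms. All
-- terms sharing the exponent of the head are removed at once, which leaves the other coefficients
-- alone. The result is no sublist known to the termination checker, so the induction runs on a
-- bound for the length.
eval-vanishes : (p : Poly n) (φ : Exponent n → ℚ) →
                (∀ β → coeff p β ℚ.* φ β ≡ 0ℚ) → eval p φ ≡ 0ℚ
eval-vanishes {n} p φ p⊥φ = go (length p) p ℕ.≤-refl p⊥φ
  where
  go : ∀ l (p : Poly n) → length p ≤ l → (∀ β → coeff p β ℚ.* φ β ≡ 0ℚ) → eval p φ ≡ 0ℚ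
  go _       []                _         _   = refl
  go (suc l) p@((c , α) ∷ p′) (s≤s p′≤l) p⊥φ = begin
    eval p φ ≡⟨ eval-without p α φ ⟩
    coeff p α ℚ.* φ α ℚ.+ eval (p without α) φ
      ≡⟨ cong₂ ℚ._+_ (p⊥φ α)
           (go l (p without α) shorter (without-vanishes p α φ (λ β _ → p⊥φ β))) ⟩
    0ℚ ∎
    where
    shorter : length (p without α) ≤ l
    shorter with α ≟ᵉ α
    ... | yes _  = ℕ.≤-trans (length-filter _ p′) p′≤l
    ... | no α≢α = contradiction refl α≢α

eval-isolate : (p : Poly n) (α : Exponent n) (φ : Exponent n → ℚ) →
               (∀ β → β ≢ α → coeff p β ℚ.* φ β ≡ 0ℚ) → eval p φ ≡ coeff p α ℚ.* φ α
eval-isolate p α φ p⊥φ = begin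
  eval p φ ≡⟨ eval-without p α φ ⟩
  coeff p α ℚ.* φ α ℚ.+ eval (p without α) φ
    ≡⟨ cong (coeff p α ℚ.* φ α ℚ.+_)
            (eval-vanishes (p without α) φ (without-vanishes p α φ p⊥φ)) ⟩
  coeff p α ℚ.* φ α ℚ.+ 0ℚ ≡⟨ ℚ.+-identityʳ _ ⟩
  coeff p α ℚ.* φ α ∎

-- Passing between coefficients and functionals

coeff-+ᴾ : (p q : Poly n) (α : Exponent n) → coeff (p +ᴾ q) α ≡ coeff p α ℚ.+ coeff q α
coeff-+ᴾ p q α = begin
  coeff (p +ᴾ q) α                           ≡⟨ coeff≡eval (p +ᴾ q) α ⟩
  eval (p +ᴾ q) (point α)                    ≡⟨ eval-+ᴾ p q (point α) ⟩
  eval p (point α) ℚ.+ eval q (point α)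
    ≡⟨ cong₂ ℚ._+_ (coeff≡eval p α) (coeff≡eval q α) ⟨
  coeff p α ℚ.+ coeff q α ∎

coeff--ᴾ : (p q : Poly n) (α : Exponent n) → coeff (p -ᴾ q) α ≡ coeff p α ℚ.- coeff q α
coeff--ᴾ p q α = begin
  coeff (p -ᴾ q) α                           ≡⟨ coeff≡eval (p -ᴾ q) α ⟩
  eval (p -ᴾ q) (point α)                    ≡⟨ eval--ᴾ p q (point α) ⟩
  eval p (point α) ℚ.- eval q (point α)
    ≡⟨ cong₂ ℚ._-_ (coeff≡eval p α) (coeff≡eval q α) ⟨
  coeff p α ℚ.- coeff q α ∎

≋⇒≈ : (p q : Poly n) → p ≋ q → p ≈ q
≋⇒≈ p q p≋q α = begin
  coeff p α        ≡⟨ coeff≡eval p α ⟩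
  eval p (point α) ≡⟨ p≋q (point α) ⟩
  eval q (point α) ≡⟨ coeff≡eval q α ⟨
  coeff q α        ∎

-- Coefficients only test against the functions `point α`. For a general φ the difference p - q is
-- used: all its coefficients are zero, so its pairing with φ vanishes.
≈⇒≋ : (p q : Poly n) → p ≈ q → p ≋ q
≈⇒≋ p q p≈q φ = begin
  eval p φ ≡⟨ solve 2 (λ x y → x := (x :+ :- y) :+ y) refl (eval p φ) (eval q φ) ⟩
  (eval p φ ℚ.- eval q φ) ℚ.+ eval q φ ≡⟨ cong (ℚ._+ eval q φ) (eval--ᴾ p q φ) ⟨
  eval (p -ᴾ q) φ ℚ.+ eval q φ ≡⟨ cong (ℚ._+ eval q φ) (eval-vanishes (p -ᴾ q) φ vanish) ⟩
  0ℚ ℚ.+ eval q φ ≡⟨ ℚ.+-identityˡ _ ⟩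
  eval q φ ∎
  where
  vanish : ∀ β → coeff (p -ᴾ q) β ℚ.* φ β ≡ 0ℚ
  vanish β = begin
    coeff (p -ᴾ q) β ℚ.* φ β ≡⟨ cong (ℚ._* φ β) (coeff--ᴾ p q β) ⟩
    (coeff p β ℚ.- coeff q β) ℚ.* φ β ≡⟨ cong (λ c → (c ℚ.- coeff q β) ℚ.* φ β) (p≈q β) ⟩
    (coeff q β ℚ.- coeff q β) ℚ.* φ β
      ≡⟨ solve 2 (λ c x → (c :+ :- c) :* x := con 0ℚ) refl (coeff q β) (φ β) ⟩
    0ℚ ∎

coeff-monomial-≡ : (α : Exponent n) → coeff (monomial α) α ≡ 1ℚ
coeff-monomial-≡ α with α ≟ᵉ α
... | yes _  = refl
... | no α≢α = contradiction refl α≢α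

coeff-monomial-≢ : {α β : Exponent n} → α ≢ β → coeff (monomial α) β ≡ 0ℚ
coeff-monomial-≢ {α = α} {β} α≢β with α ≟ᵉ β
... | yes α≡β = contradiction α≡β α≢β
... | no _    = refl

eval-monomial : (α : Exponent n) (φ : Exponent n → ℚ) → eval (monomial α) φ ≡ φ α
eval-monomial α φ = solve 1 (λ x → con 1ℚ :* x :+ con 0ℚ := x) refl (φ α)

-- Supports

∈supp-monomial : {α β : Exponent n} → β ∈supp monomial α → β ≡ α
∈supp-monomial {α = α} {β} β∈ with α ≟ᵉ β
... | yes α≡β = sym α≡β
... | no _    = contradiction refl β∈

∈supp-+ᴾ : (p q : Poly n) {α : Exponent n} → α ∈supp (p +ᴾ q) → α ∈supp p ⊎ α ∈supp q
∈supp-+ᴾ p q {α} α∈ with coeff p α ℚ.≟ 0ℚ | coeff q α ℚ.≟ 0ℚ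
... | no α∈p  | _        = inj₁ α∈p
... | yes _   | no α∈q   = inj₂ α∈q
... | yes p≡0 | yes q≡0 = contradiction (trans (coeff-+ᴾ p q α) (cong₂ ℚ._+_ p≡0 q≡0)) α∈

∈supp--ᴾ : (p q : Poly n) {α : Exponent n} → α ∈supp (p -ᴾ q) → α ∈supp p ⊎ α ∈supp q
∈supp--ᴾ p q {α} α∈ with coeff p α ℚ.≟ 0ℚ | coeff q α ℚ.≟ 0ℚ
... | no α∈p  | _        = inj₁ α∈p
... | yes _   | no α∈q   = inj₂ α∈q
... | yes p≡0 | yes q≡0 = contradiction (trans (coeff--ᴾ p q α) (cong₂ ℚ._-_ p≡0 q≡0)) α∈

∈supp⇒∈exponents : (p : Poly n) {α : Exponent n} → α ∈supp p → α ∈ᴸ List.map proj₂ p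
∈supp⇒∈exponents []            α∈ = contradiction refl α∈
∈supp⇒∈exponents ((c , β) ∷ p) {α} α∈ with β ≟ᵉ α
... | yes β≡α = here (sym β≡α)
... | no _    = there (∈supp⇒∈exponents p α∈)

_∈supp?_ : (α : Exponent n) (p : Poly n) → Dec (α ∈supp p)
α ∈supp? p = ¬? (coeff p α ℚ.≟ 0ℚ)

-- The support lies within the finite list of written exponents. Membership in the support is tested
-- again during the search, as a written exponent may have coefficient zero.
any-supp? : (p : Poly n) {P : Pred (Exponent n) 0ℓ} → Decidable P →
            Dec (∃[ β ] β ∈supp p × P β)
any-supp? p P? =
  map′ (λ any → let β , _ , β∈,Pβ = find any in β , β∈,Pβ)
       (λ (β , β∈,Pβ) → lose (∈supp⇒∈exponents p (proj₁ β∈,Pβ)) β∈,Pβ)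
       (any? (λ β → (β ∈supp? p) ×-dec P? β) (List.map proj₂ p))

-- Ideals

combination-+ : (h h′ f : Vec (Poly n) r) →
                combination (zipWith _+ᴾ_ h h′) f ≋ combination h f +ᴾ combination h′ f
combination-+ []      []        []      φ = refl
combination-+ (t ∷ h) (t′ ∷ h′) (g ∷ f) φ = begin
  eval ((t +ᴾ t′) *ᴾ g +ᴾ combination (zipWith _+ᴾ_ h h′) f) φ
    ≡⟨ eval-+ᴾ ((t +ᴾ t′) *ᴾ g) _ φ ⟩
  eval ((t +ᴾ t′) *ᴾ g) φ ℚ.+ eval (combination (zipWith _+ᴾ_ h h′) f) φ
    ≡⟨ cong₂ ℚ._+_ (trans (cong (flip eval φ) (cartesianProductWith-distribʳ-++ _ t t′ g))
                          (eval-+ᴾ (t *ᴾ g) _ φ))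
                   (trans (combination-+ h h′ f φ) (eval-+ᴾ (combination h f) _ φ)) ⟩
  (eval (t *ᴾ g) φ ℚ.+ eval (t′ *ᴾ g) φ) ℚ.+ (eval (combination h f) φ ℚ.+ eval (combination h′ f) φ)
    ≡⟨ solve 4 (λ x y u v → (x :+ y) :+ (u :+ v) := (x :+ u) :+ (y :+ v)) refl
         (eval (t *ᴾ g) φ) (eval (t′ *ᴾ g) φ) (eval (combination h f) φ) (eval (combination h′ f) φ) ⟩
  (eval (t *ᴾ g) φ ℚ.+ eval (combination h f) φ) ℚ.+ (eval (t′ *ᴾ g) φ ℚ.+ eval (combination h′ f) φ)
    ≡⟨ cong₂ ℚ._+_ (eval-+ᴾ (t *ᴾ g) _ φ) (eval-+ᴾ (t′ *ᴾ g) _ φ) ⟨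
  eval (combination (t ∷ h) (g ∷ f)) φ ℚ.+ eval (combination (t′ ∷ h′) (g ∷ f)) φ
    ≡⟨ eval-+ᴾ (combination (t ∷ h) (g ∷ f)) _ φ ⟨
  eval (combination (t ∷ h) (g ∷ f) +ᴾ combination (t′ ∷ h′) (g ∷ f)) φ ∎

*ᴾ-assoc : (p q t : Poly n) → (p *ᴾ q) *ᴾ t ≋ p *ᴾ (q *ᴾ t)
*ᴾ-assoc p q t φ = begin
  eval ((p *ᴾ q) *ᴾ t) φ ≡⟨ eval-*ᴾ (p *ᴾ q) t φ ⟩
  eval (p *ᴾ q) (λ γ → eval t (φ ∘ (γ ⊕_))) ≡⟨ eval-*ᴾ p q _ ⟩
  eval p (λ α → eval q (λ β → eval t (φ ∘ ((α ⊕ β) ⊕_))))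
    ≡⟨ (eval-cong p λ α → eval-cong q λ β → eval-cong t λ γ → cong φ (⊕-assoc α β γ)) ⟩
  eval p (λ α → eval q (λ β → eval t (λ γ → φ (α ⊕ (β ⊕ γ)))))
    ≡⟨ (eval-cong p λ α → eval-*ᴾ q t (φ ∘ (α ⊕_))) ⟨
  eval p (λ α → eval (q *ᴾ t) (φ ∘ (α ⊕_))) ≡⟨ eval-*ᴾ p (q *ᴾ t) φ ⟨
  eval (p *ᴾ (q *ᴾ t)) φ ∎

*ᴾ-distribˡ : (p q t : Poly n) → p *ᴾ (q +ᴾ t) ≋ p *ᴾ q +ᴾ p *ᴾ t
*ᴾ-distribˡ p q t φ = begin
  eval (p *ᴾ (q +ᴾ t)) φ ≡⟨ eval-*ᴾ p (q +ᴾ t) φ ⟩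
  eval p (λ γ → eval (q +ᴾ t) (φ ∘ (γ ⊕_))) ≡⟨ (eval-cong p λ γ → eval-+ᴾ q t (φ ∘ (γ ⊕_))) ⟩
  eval p (λ γ → eval q (φ ∘ (γ ⊕_)) ℚ.+ eval t (φ ∘ (γ ⊕_))) ≡⟨ eval-+ p _ _ ⟩
  eval p (λ γ → eval q (φ ∘ (γ ⊕_))) ℚ.+ eval p (λ γ → eval t (φ ∘ (γ ⊕_)))
    ≡⟨ cong₂ ℚ._+_ (eval-*ᴾ p q φ) (eval-*ᴾ p t φ) ⟨
  eval (p *ᴾ q) φ ℚ.+ eval (p *ᴾ t) φ ≡⟨ eval-+ᴾ (p *ᴾ q) _ φ ⟨
  eval (p *ᴾ q +ᴾ p *ᴾ t) φ ∎

*ᴾ-congʳ : (p q t : Poly n) → q ≋ t → p *ᴾ q ≋ p *ᴾ t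
*ᴾ-congʳ p q t q≋t φ = begin
  eval (p *ᴾ q) φ                      ≡⟨ eval-*ᴾ p q φ ⟩
  eval p (λ γ → eval q (φ ∘ (γ ⊕_)))   ≡⟨ (eval-cong p λ γ → q≋t (φ ∘ (γ ⊕_))) ⟩
  eval p (λ γ → eval t (φ ∘ (γ ⊕_)))   ≡⟨ eval-*ᴾ p t φ ⟨
  eval (p *ᴾ t) φ                      ∎

combination-* : (t : Poly n) (h f : Vec (Poly n) r) →
                combination (Vec.map (t *ᴾ_) h) f ≋ t *ᴾ combination h f
combination-* t []      []      φ =
  cong (flip eval φ) (sym (cartesianProductWith-zeroʳ _ t))
combination-* t (q ∷ h) (g ∷ f) φ = begin
  eval ((t *ᴾ q) *ᴾ g +ᴾ combination (Vec.map (t *ᴾ_) h) f) φ ≡⟨ eval-+ᴾ ((t *ᴾ q) *ᴾ g) _ φ ⟩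
  eval ((t *ᴾ q) *ᴾ g) φ ℚ.+ eval (combination (Vec.map (t *ᴾ_) h) f) φ
    ≡⟨ cong₂ ℚ._+_ (*ᴾ-assoc t q g φ) (combination-* t h f φ) ⟩
  eval (t *ᴾ (q *ᴾ g)) φ ℚ.+ eval (t *ᴾ combination h f) φ ≡⟨ eval-+ᴾ (t *ᴾ (q *ᴾ g)) _ φ ⟨
  eval (t *ᴾ (q *ᴾ g) +ᴾ t *ᴾ combination h f) φ ≡⟨ *ᴾ-distribˡ t (q *ᴾ g) (combination h f) φ ⟨
  eval (t *ᴾ (q *ᴾ g +ᴾ combination h f)) φ ∎

0ᶜ : Vec (Poly n) r
0ᶜ = replicate _ []

combination-0 : (f : Vec (Poly n) r) → combination 0ᶜ f ≡ []
combination-0 []      = refl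
combination-0 (g ∷ f) = combination-0 f

combination-single : (i : Fin r) (t : Poly n) (f : Vec (Poly n) r) →
                     combination (0ᶜ [ i ]≔ t) f ≡ t *ᴾ lookup f i
combination-single zero    t (g ∷ f) = trans (cong (t *ᴾ g ++_) (combination-0 f)) (++-identityʳ _)
combination-single (suc i) t (g ∷ f) = combination-single i t f

module _ {f : Vec (Poly n) r} where

  Ideal-resp-≋ : (p q : Poly n) → p ≋ q → p ∈ Ideal f → q ∈ Ideal f
  Ideal-resp-≋ p q p≋q (h , p≈h) = h , λ α → trans (sym (≋⇒≈ p q p≋q α)) (p≈h α)

  Ideal-+ : (p q : Poly n) → p ∈ Ideal f → q ∈ Ideal f → p +ᴾ q ∈ Ideal f
  Ideal-+ p q (h , p≈h) (h′ , q≈h′) =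
    zipWith _+ᴾ_ h h′ , ≋⇒≈ (p +ᴾ q) (combination (zipWith _+ᴾ_ h h′) f) λ φ → begin
    eval (p +ᴾ q) φ ≡⟨ eval-+ᴾ p q φ ⟩
    eval p φ ℚ.+ eval q φ ≡⟨ cong₂ ℚ._+_ (≈⇒≋ p (combination h f) p≈h φ) (≈⇒≋ q (combination h′ f) q≈h′ φ) ⟩
    eval (combination h f) φ ℚ.+ eval (combination h′ f) φ ≡⟨ eval-+ᴾ (combination h f) _ φ ⟨
    eval (combination h f +ᴾ combination h′ f) φ ≡⟨ combination-+ h h′ f φ ⟨
    eval (combination (zipWith _+ᴾ_ h h′) f) φ ∎

  Ideal-* : (t p : Poly n) → p ∈ Ideal f → t *ᴾ p ∈ Ideal f
  Ideal-* t p (h , p≈h) = Vec.map (t *ᴾ_) h , ≋⇒≈ (t *ᴾ p) (combination (Vec.map (t *ᴾ_) h) f) λ φ →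
    trans (*ᴾ-congʳ t p (combination h f) (≈⇒≋ p (combination h f) p≈h) φ) (sym (combination-* t h f φ))

  Ideal-0 : [] ∈ Ideal f
  Ideal-0 = 0ᶜ , λ α → cong (flip coeff α) (sym (combination-0 f))

  Ideal-- : (p q : Poly n) → p ∈ Ideal f → q ∈ Ideal f → p -ᴾ q ∈ Ideal f
  Ideal-- p q p∈ q∈ =
    Ideal-resp-≋ (p +ᴾ -1ᴾ *ᴾ q) (p -ᴾ q) subtract (Ideal-+ p (-1ᴾ *ᴾ q) p∈ (Ideal-* -1ᴾ q q∈))
    where
    -1ᴾ : Poly n
    -1ᴾ = (ℚ.- 1ℚ , replicate n 0) ∷ []

    subtract : p +ᴾ -1ᴾ *ᴾ q ≋ p -ᴾ q
    subtract φ = begin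
      eval (p +ᴾ -1ᴾ *ᴾ q) φ ≡⟨ eval-+ᴾ p (-1ᴾ *ᴾ q) φ ⟩
      eval p φ ℚ.+ eval (-1ᴾ *ᴾ q) φ ≡⟨ cong (eval p φ ℚ.+_) (eval-*ᴾ -1ᴾ q φ) ⟩
      eval p φ ℚ.+ (ℚ.- 1ℚ ℚ.* eval q (φ ∘ (replicate n 0 ⊕_)) ℚ.+ 0ℚ)
        ≡⟨ cong (λ e → eval p φ ℚ.+ (ℚ.- 1ℚ ℚ.* e ℚ.+ 0ℚ))
                (eval-cong q λ α → cong φ (⊕-identityˡ α)) ⟩
      eval p φ ℚ.+ (ℚ.- 1ℚ ℚ.* eval q φ ℚ.+ 0ℚ)
        ≡⟨ solve 2 (λ x y → x :+ (:- con 1ℚ :* y :+ con 0ℚ) := x :+ :- y) refl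
                   (eval p φ) (eval q φ) ⟩
      eval p φ ℚ.- eval q φ ≡⟨ eval--ᴾ p q φ ⟨
      eval (p -ᴾ q) φ ∎

  Ideal-swap : (p q : Poly n) → p -ᴾ q ∈ Ideal f → q -ᴾ p ∈ Ideal f
  Ideal-swap p q p-q∈ =
    Ideal-resp-≋ ([] -ᴾ (p -ᴾ q)) (q -ᴾ p) negate (Ideal-- [] (p -ᴾ q) Ideal-0 p-q∈)
    where
    negate : [] -ᴾ (p -ᴾ q) ≋ q -ᴾ p
    negate φ = begin
      eval ([] -ᴾ (p -ᴾ q)) φ ≡⟨ eval-neg (p -ᴾ q) φ ⟩
      ℚ.- eval (p -ᴾ q) φ ≡⟨ cong ℚ.-_ (eval--ᴾ p q φ) ⟩
      ℚ.- (eval p φ ℚ.- eval q φ)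
        ≡⟨ solve 2 (λ x y → :- (x :+ :- y) := y :+ :- x) refl (eval p φ) (eval q φ) ⟩
      eval q φ ℚ.- eval p φ ≡⟨ eval--ᴾ q p φ ⟨
      eval (q -ᴾ p) φ ∎

  Ideal-telescope : (p q t : Poly n) → p -ᴾ q ∈ Ideal f → q -ᴾ t ∈ Ideal f → p -ᴾ t ∈ Ideal f
  Ideal-telescope p q t p-q∈ q-t∈ =
    Ideal-resp-≋ ((p -ᴾ q) +ᴾ (q -ᴾ t)) (p -ᴾ t) telescope (Ideal-+ (p -ᴾ q) (q -ᴾ t) p-q∈ q-t∈)
    where
    telescope : (p -ᴾ q) +ᴾ (q -ᴾ t) ≋ p -ᴾ t
    telescope φ = begin
      eval ((p -ᴾ q) +ᴾ (q -ᴾ t)) φ ≡⟨ eval-+ᴾ (p -ᴾ q) (q -ᴾ t) φ ⟩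
      eval (p -ᴾ q) φ ℚ.+ eval (q -ᴾ t) φ ≡⟨ cong₂ ℚ._+_ (eval--ᴾ p q φ) (eval--ᴾ q t φ) ⟩
      (eval p φ ℚ.- eval q φ) ℚ.+ (eval q φ ℚ.- eval t φ)
        ≡⟨ solve 3 (λ x y z → (x :+ :- y) :+ (y :+ :- z) := x :+ :- z) refl (eval p φ) (eval q φ) (eval t φ) ⟩
      eval p φ ℚ.- eval t φ ≡⟨ eval--ᴾ p t φ ⟨
      eval (p -ᴾ t) φ ∎

  generator∈Ideal : (i : Fin r) → lookup f i ∈ Ideal f
  generator∈Ideal i = 0ᶜ [ i ]≔ 1ᴾ , ≋⇒≈ (lookup f i) (combination (0ᶜ [ i ]≔ 1ᴾ) f) λ φ → begin
    eval (lookup f i) φ ≡⟨ eval-cong (lookup f i) (λ α → cong φ (⊕-identityˡ α)) ⟨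
    eval (lookup f i) (φ ∘ (replicate n 0 ⊕_))
      ≡⟨ eval-monomial (replicate n 0) (λ γ → eval (lookup f i) (φ ∘ (γ ⊕_))) ⟨
    eval 1ᴾ (λ γ → eval (lookup f i) (φ ∘ (γ ⊕_))) ≡⟨ eval-*ᴾ 1ᴾ (lookup f i) φ ⟨
    eval (1ᴾ *ᴾ lookup f i) φ ≡⟨ cong (flip eval φ) (combination-single i 1ᴾ f) ⟨
    eval (combination (0ᶜ [ i ]≔ 1ᴾ) f) φ ∎
    where
    1ᴾ : Poly n
    1ᴾ = monomial (replicate n 0)

-- Monomial orderings and Gröbner bases

eval-singleton-* : (c : ℚ) (δ : Exponent n) (p : Poly n) (φ : Exponent n → ℚ) →
                   eval (((c , δ) ∷ []) *ᴾ p) φ ≡ c ℚ.* eval p (φ ∘ (δ ⊕_))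
eval-singleton-* c δ p φ = trans (eval-*ᴾ ((c , δ) ∷ []) p φ) (ℚ.+-identityʳ _)

-- Translation by δ is injective, so only β lands on δ ⊕ β.
coeff-singleton-* : (c : ℚ) (δ : Exponent n) (p : Poly n) (β : Exponent n) →
                    coeff (((c , δ) ∷ []) *ᴾ p) (δ ⊕ β) ≡ c ℚ.* coeff p β
coeff-singleton-* c δ p β = begin
  coeff (((c , δ) ∷ []) *ᴾ p) (δ ⊕ β) ≡⟨ coeff≡eval (((c , δ) ∷ []) *ᴾ p) (δ ⊕ β) ⟩
  eval (((c , δ) ∷ []) *ᴾ p) (point (δ ⊕ β)) ≡⟨ eval-singleton-* c δ p (point (δ ⊕ β)) ⟩
  c ℚ.* eval p (point (δ ⊕ β) ∘ (δ ⊕_))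
    ≡⟨ cong (c ℚ.*_) (eval-cong p λ α →
         indicator-⇔ (δ ⊕ α ≟ᵉ δ ⊕ β) (α ≟ᵉ β) (⊕-cancelˡ δ) (cong (δ ⊕_))) ⟩
  c ℚ.* eval p (point β) ≡⟨ cong (c ℚ.*_) (coeff≡eval p β) ⟨
  c ℚ.* coeff p β ∎

∈supp-singleton-* : (c : ℚ) (δ : Exponent n) (p : Poly n) {α : Exponent n} →
                    α ∈supp (((c , δ) ∷ []) *ᴾ p) → ∃[ β ] β ∈supp p × α ≡ δ ⊕ β
∈supp-singleton-* c δ p {α} α∈ with any-supp? p (λ β → α ≟ᵉ δ ⊕ β)
... | yes found = found
... | no ¬found = contradiction vanish α∈
  where
  vanishes : ∀ β → coeff p β ℚ.* point α (δ ⊕ β) ≡ 0ℚ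
  vanishes β with coeff p β ℚ.≟ 0ℚ
  ... | yes p≡0 = trans (cong (ℚ._* point α (δ ⊕ β)) p≡0) (ℚ.*-zeroˡ (point α (δ ⊕ β)))
  ... | no β∈   = trans (cong (coeff p β ℚ.*_) (indicator-no (δ ⊕ β ≟ᵉ α) λ eq → ¬found (β , β∈ , sym eq)))
                        (ℚ.*-zeroʳ (coeff p β))

  vanish : coeff (((c , δ) ∷ []) *ᴾ p) α ≡ 0ℚ
  vanish = begin
    coeff (((c , δ) ∷ []) *ᴾ p) α ≡⟨ coeff≡eval (((c , δ) ∷ []) *ᴾ p) α ⟩
    eval (((c , δ) ∷ []) *ᴾ p) (point α) ≡⟨ eval-singleton-* c δ p (point α) ⟩
    c ℚ.* eval p (point α ∘ (δ ⊕_)) ≡⟨ cong (c ℚ.*_) (eval-vanishes p _ vanishes) ⟩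
    c ℚ.* 0ℚ ≡⟨ ℚ.*-zeroʳ c ⟩
    0ℚ ∎

module MonomialOrderingProperties (ord : MonomialOrdering n) where
  open MonomialOrdering ord public
  open IsStrictTotalOrder isStrictTotalOrder public
    using (compare; irrefl; asym) renaming (trans to ≺-trans)

  ≼-≺-trans : {α β γ : Exponent n} → α ≼ β → β ≺ γ → α ≺ γ
  ≼-≺-trans (inj₁ α≺β)  β≺γ = ≺-trans α≺β β≺γ
  ≼-≺-trans (inj₂ refl) β≺γ = β≺γ

  ≼-trans : {α β γ : Exponent n} → α ≼ β → β ≼ γ → α ≼ γ
  ≼-trans α≼β (inj₁ β≺γ)  = inj₁ (≼-≺-trans α≼β β≺γ)
  ≼-trans α≼β (inj₂ refl) = α≼β

  ≼-antisym : {α β : Exponent n} → α ≼ β → β ≼ α → α ≡ β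
  ≼-antisym (inj₂ α≡β) _          = α≡β
  ≼-antisym (inj₁ _)   (inj₂ β≡α) = sym β≡α
  ≼-antisym (inj₁ α≺β) (inj₁ β≺α) = contradiction β≺α (asym α≺β)

  ≼∧≢⇒≺ : {α β : Exponent n} → α ≼ β → α ≢ β → α ≺ β
  ≼∧≢⇒≺ (inj₁ α≺β) _   = α≺β
  ≼∧≢⇒≺ (inj₂ α≡β) α≢β = contradiction α≡β α≢β

  ⊕-mono-≼ : (γ : Exponent n) {α β : Exponent n} → α ≼ β → (α ⊕ γ) ≼ (β ⊕ γ)
  ⊕-mono-≼ γ (inj₁ α≺β)  = inj₁ (⊕-monoˡ γ α≺β)
  ⊕-mono-≼ γ (inj₂ refl) = inj₂ refl

  maximum : {P : Pred (Exponent n) 0ℓ} → Decidable P → (αs : List (Exponent n)) →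
            (∀ β → β ∈ᴸ αs → ¬ P β) ⊎ (∃[ μ ] P μ × (∀ β → β ∈ᴸ αs → P β → β ≼ μ))
  maximum P? []       = inj₁ λ _ ()
  maximum P? (α ∷ αs) with P? α | maximum P? αs
  ... | no ¬Pα | inj₁ none = inj₁ λ { β (here refl) → ¬Pα ; β (there β∈) → none β β∈ }
  ... | yes Pα | inj₁ none = inj₂ (α , Pα , λ where
    β (here β≡α) _  → inj₂ β≡α
    β (there β∈) Pβ → contradiction Pβ (none β β∈))
  ... | no ¬Pα | inj₂ (μ , Pμ , μ-max) = inj₂ (μ , Pμ , λ where
    β (here refl) Pα → contradiction Pα ¬Pα
    β (there β∈)  Pβ → μ-max β β∈ Pβ)
  ... | yes Pα | inj₂ (μ , Pμ , μ-max) with compare α μ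
  ...   | tri< α≺μ _ _ = inj₂ (μ , Pμ , λ where
    β (here refl) _  → inj₁ α≺μ
    β (there β∈)  Pβ → μ-max β β∈ Pβ)
  ...   | tri≈ _ α≡μ _ = inj₂ (μ , Pμ , λ where
    β (here refl) _  → inj₂ α≡μ
    β (there β∈)  Pβ → μ-max β β∈ Pβ)
  ...   | tri> _ _ μ≺α = inj₂ (α , Pα , λ where
    β (here β≡α) _  → inj₂ β≡α
    β (there β∈) Pβ → inj₁ (≼-≺-trans (μ-max β β∈ Pβ) μ≺α))

  -- Coefficients are rationals with decidable equality, so the largest written exponent with
  -- nonzero coefficient can be searched for. If there is none, every coefficient is zero.
  leading : (p : Poly n) → p ≈ [] ⊎ ∃ (IsExp ord p)
  leading p with maximum (_∈supp? p) (List.map proj₂ p)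
  ... | inj₁ none = inj₁ λ α → decidable-stable (coeff p α ℚ.≟ 0ℚ) λ α∈ →
    none α (∈supp⇒∈exponents p α∈) α∈
  ... | inj₂ (μ , μ∈ , μ-max) = inj₂ (μ , record
    { inSupport = μ∈
    ; maximal   = λ β β∈ → μ-max β (∈supp⇒∈exponents p β∈) β∈
    })

  IsExp-unique : (p : Poly n) {α β : Exponent n} → IsExp ord p α → IsExp ord p β → α ≡ β
  IsExp-unique p expα expβ = ≼-antisym (IsExp.maximal expβ _ (IsExp.inSupport expα))
                                       (IsExp.maximal expα _ (IsExp.inSupport expβ))

  IsExp-monomial : (α : Exponent n) → IsExp ord (monomial α) α
  IsExp-monomial α = record
    { inSupport = λ eq → contradiction (trans (sym (coeff-monomial-≡ α)) eq) λ ()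
    ; maximal   = λ β β∈ → inj₂ (∈supp-monomial β∈)
    }

  IsExp-binomial : {α β : Exponent n} → β ≺ α → IsExp ord (monomial α -ᴾ monomial β) α
  IsExp-binomial {α} {β} β≺α = record
    { inSupport = λ eq → contradiction (trans (sym leadingCoeff) eq) λ ()
    ; maximal   = λ γ γ∈ → below (∈supp--ᴾ (monomial α) (monomial β) γ∈)
    }
    where
    leadingCoeff : coeff (monomial α -ᴾ monomial β) α ≡ 1ℚ
    leadingCoeff = begin
      coeff (monomial α -ᴾ monomial β) α         ≡⟨ coeff--ᴾ (monomial α) (monomial β) α ⟩
      coeff (monomial α) α ℚ.- coeff (monomial β) α
        ≡⟨ cong₂ ℚ._-_ (coeff-monomial-≡ α) (coeff-monomial-≢ λ β≡α → irrefl β≡α β≺α) ⟩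
      1ℚ ∎

    below : ∀ {γ} → γ ∈supp monomial α ⊎ γ ∈supp monomial β → γ ≼ α
    below (inj₁ γ∈) = inj₂ (∈supp-monomial γ∈)
    below (inj₂ γ∈) = inj₁ (subst (_≺ α) (sym (∈supp-monomial γ∈)) β≺α)

  -- Division by a reduced Gröbner basis

  module GroebnerProperties {s} {f : Vec (Poly n) s} {G : Vec (Poly n) r}
                            (isReduced : IsReducedGroebnerBasis ord (Ideal f) G) where
    open IsReducedGroebnerBasis isReduced
    open IsGroebnerBasis isGroebnerBasis

    -- Each basis element is nonzero and has exactly one leading exponent, so divisibility by the
    -- one that `leading` finds settles the question.
    E? : Decidable (E ord G)
    E? α = map′ (λ (i , γ , exp , δ , eq) → i , γ , δ , exp , eq)
                (λ (i , γ , δ , exp , eq) → i , γ , exp , δ , eq)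
                (Fin.any? divisibleBy?)
      where
      divisibleBy? : ∀ i → Dec (∃[ γ ] IsExp ord (lookup G i) γ × ∃[ δ ] α ≡ γ ⊕ δ)
      divisibleBy? i with leading (lookup G i)
      ... | inj₁ g≈0       = contradiction g≈0 (nonzero i)
      ... | inj₂ (γ , exp) = map′ (λ γ∣α → γ , exp , γ∣α)
        (λ (γ′ , exp′ , γ′∣α) →
          subst (λ γ → ∃[ δ ] α ≡ γ ⊕ δ) (IsExp-unique (lookup G i) exp′ exp) γ′∣α)
        (divides? γ α)

    -- The bound concerns every exponent of a product and not only its leading one. In this form it
    -- survives the addition of quotients, even when leading terms cancel.
    Division : Poly n → Exponent n → Set
    Division p γ = ∃[ q ] p ≈ combination q G ×
                          (∀ i β → β ∈supp (lookup q i *ᴾ lookup G i) → β ≼ γ)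

    zero-division : (p : Poly n) {γ : Exponent n} → p ≈ [] → Division p γ
    zero-division p p≈0 =
      0ᶜ , (λ α → trans (p≈0 α) (cong (flip coeff α) (sym (combination-0 G)))) ,
      λ i β β∈ → contradiction
        (cong (λ t → coeff (t *ᴾ lookup G i) β) (Vec.lookup-replicate i [])) β∈

    Division-weaken : (p : Poly n) {γ γ′ : Exponent n} → γ′ ≼ γ → Division p γ′ → Division p γ
    Division-weaken p γ′≼γ (q , eq , below) = q , eq , λ i β β∈ → ≼-trans (below i β β∈) γ′≼γ

    -- The division algorithm for an element of the ideal. `covering` makes each leading term
    -- reducible, and the reduced polynomial is again in the ideal with a smaller leading exponent
    -- or zero; hence no remainder is left.
    divide : ∀ {γ} → Acc _≺_ γ → ∀ p → p ∈ Ideal f → IsExp ord p γ → Division p γ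
    divide {γ} (acc rec) p p∈ exp with covering p p∈ γ exp
    ... | i , γᵢ , δ , expᵢ , refl = extend remainder
      where
      g t p′ : Poly n
      g  = lookup G i
      -- No division by a leading coefficient occurs, because g is monic.
      t  = (coeff p γ , δ) ∷ []
      p′ = p -ᴾ t *ᴾ g

      cancels : coeff p′ γ ≡ 0ℚ
      cancels = begin
        coeff p′ γ ≡⟨ coeff--ᴾ p (t *ᴾ g) γ ⟩
        coeff p γ ℚ.- coeff (t *ᴾ g) γ
          ≡⟨ cong (λ α → coeff p γ ℚ.- coeff (t *ᴾ g) α) (⊕-comm γᵢ δ) ⟩
        coeff p γ ℚ.- coeff (t *ᴾ g) (δ ⊕ γᵢ)
          ≡⟨ cong (λ c → coeff p γ ℚ.- c) (coeff-singleton-* (coeff p γ) δ g γᵢ) ⟩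
        coeff p γ ℚ.- coeff p γ ℚ.* coeff g γᵢ
          ≡⟨ cong (λ c → coeff p γ ℚ.- coeff p γ ℚ.* c) (monic i γᵢ expᵢ) ⟩
        coeff p γ ℚ.- coeff p γ ℚ.* 1ℚ
          ≡⟨ solve 1 (λ c → c :+ :- (c :* con 1ℚ) := con 0ℚ) refl (coeff p γ) ⟩
        0ℚ ∎

      t*g≼γ : ∀ β → β ∈supp (t *ᴾ g) → β ≼ γ
      t*g≼γ β β∈ with ∈supp-singleton-* (coeff p γ) δ g β∈
      ... | β′ , β′∈ , refl =
        subst (_≼ γ) (⊕-comm β′ δ) (⊕-mono-≼ δ (IsExp.maximal expᵢ β′ β′∈))

      p′≼γ : ∀ {β} → β ∈supp p ⊎ β ∈supp (t *ᴾ g) → β ≼ γ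
      p′≼γ (inj₁ β∈) = IsExp.maximal exp _ β∈
      p′≼γ (inj₂ β∈) = t*g≼γ _ β∈

      remainder : Division p′ γ
      remainder with leading p′
      ... | inj₁ p′≈0 = zero-division p′ p′≈0
      ... | inj₂ (γ′ , exp′) = Division-weaken p′ (inj₁ γ′≺γ) (divide (rec γ′≺γ) p′ p′∈ exp′)
        where
        p′∈ : p′ ∈ Ideal f
        p′∈ = Ideal-- p (t *ᴾ g) p∈ (Ideal-* t g (subset i))

        γ′≺γ : γ′ ≺ γ
        γ′≺γ = ≼∧≢⇒≺ (p′≼γ (∈supp--ᴾ p (t *ᴾ g) (IsExp.inSupport exp′)))
                     λ { refl → IsExp.inSupport exp′ cancels }

      extend : Division p′ γ → Division p γ
      extend (q , p′≈ , below) =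
        zipWith _+ᴾ_ q u , ≋⇒≈ p (combination (zipWith _+ᴾ_ q u) G) divided , below⁺
        where
        u : Vec (Poly n) r
        u = 0ᶜ [ i ]≔ t

        divided : p ≋ combination (zipWith _+ᴾ_ q u) G
        divided φ = begin
          eval p φ
            ≡⟨ solve 2 (λ x y → x := (x :+ :- y) :+ y) refl (eval p φ) (eval (t *ᴾ g) φ) ⟩
          (eval p φ ℚ.- eval (t *ᴾ g) φ) ℚ.+ eval (t *ᴾ g) φ
            ≡⟨ cong₂ ℚ._+_ (eval--ᴾ p (t *ᴾ g) φ) (cong (flip eval φ) (combination-single i t G)) ⟨
          eval p′ φ ℚ.+ eval (combination u G) φ
            ≡⟨ cong (ℚ._+ eval (combination u G) φ) (≈⇒≋ p′ (combination q G) p′≈ φ) ⟩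
          eval (combination q G) φ ℚ.+ eval (combination u G) φ
            ≡⟨ eval-+ᴾ (combination q G) (combination u G) φ ⟨
          eval (combination q G +ᴾ combination u G) φ ≡⟨ combination-+ q u G φ ⟨
          eval (combination (zipWith _+ᴾ_ q u) G) φ ∎

        below-u : ∀ l β → β ∈supp (lookup u l *ᴾ lookup G l) → β ≼ γ
        below-u l β β∈ with l Fin.≟ i
        ... | yes refl = t*g≼γ β (subst (λ t → β ∈supp (t *ᴾ g)) (Vec.lookup∘update i 0ᶜ t) β∈)
        ... | no l≢i   = contradiction
          (cong (λ t → coeff (t *ᴾ lookup G l) β)
                (trans (Vec.lookup∘update′ l≢i 0ᶜ t) (Vec.lookup-replicate l []))) β∈

        below⁺ : ∀ l β → β ∈supp (lookup (zipWith _+ᴾ_ q u) l *ᴾ lookup G l) → β ≼ γ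
        below⁺ l β β∈ with ∈supp-+ᴾ (lookup q l *ᴾ lookup G l) (lookup u l *ᴾ lookup G l)
          (subst (β ∈supp_)
            (trans (cong (_*ᴾ lookup G l) (Vec.lookup-zipWith _+ᴾ_ l q u))
                   (cartesianProductWith-distribʳ-++ _ (lookup q l) (lookup u l) (lookup G l))) β∈)
        ... | inj₁ β∈q = below l β β∈q
        ... | inj₂ β∈u = below-u l β β∈u

    ideal-division : (p : Poly n) {γ : Exponent n} → p ∈ Ideal f →
                     (∀ β → β ∈supp p → β ≼ γ) → Division p γ
    ideal-division p p∈ p≼γ with leading p
    ... | inj₁ p≈0        = zero-division p p≈0
    ... | inj₂ (γ′ , exp) =
      Division-weaken p (p≼γ γ′ (IsExp.inSupport exp)) (divide (wellFounded γ′) p p∈ exp)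

-- Toric ideals

weighted-0 : (a : Vec ℕ k) → weighted a (replicate k 0) ≡ 0
weighted-0 []      = refl
weighted-0 (_ ∷ a) = weighted-0 a

weighted-⊕ : (a α β : Vec ℕ k) → weighted a (α ⊕ β) ≡ weighted a α + weighted a β
weighted-⊕ []      []      []      = refl
weighted-⊕ (w ∷ a) (c ∷ α) (d ∷ β) = begin
  (c + d) ℕ.* w + weighted a (α ⊕ β)
    ≡⟨ cong₂ _+_ (ℕ.*-distribʳ-+ w c d) (weighted-⊕ a α β) ⟩
  (c ℕ.* w + d ℕ.* w) + (weighted a α + weighted a β)
    ≡⟨ ℕ-solve 4 (λ x y u v → (x :+ℕ y) :+ℕ (u :+ℕ v) :=ℕ (x :+ℕ u) :+ℕ (y :+ℕ v)) refl
         (c ℕ.* w) (d ℕ.* w) (weighted a α) (weighted a β) ⟩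
  (c ℕ.* w + weighted a α) + (d ℕ.* w + weighted a β) ∎

unit : Fin k → Exponent k
unit i = replicate _ 0 [ i ]≔ 1

weighted-unit : (a : Vec ℕ k) (i : Fin k) → weighted a (unit i) ≡ lookup a i
weighted-unit (w ∷ a) zero    = trans (cong₂ _+_ (ℕ.*-identityˡ w) (weighted-0 a)) (ℕ.+-identityʳ w)
weighted-unit (w ∷ a) (suc i) = weighted-unit a i

weighted-removeAt : (a α : Vec ℕ (suc m)) (j : Fin (suc m)) →
  weighted a α ≡ lookup α j ℕ.* lookup a j + weighted (removeAt a j) (removeAt α j)
weighted-removeAt (w ∷ a)       (c ∷ α)       zero    = refl
weighted-removeAt (w ∷ a@(_ ∷ _)) (c ∷ α@(_ ∷ _)) (suc j) = begin
  c ℕ.* w + weighted a α ≡⟨ cong (c ℕ.* w +_) (weighted-removeAt a α j) ⟩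
  c ℕ.* w + (lookup α j ℕ.* lookup a j + weighted (removeAt a j) (removeAt α j))
    ≡⟨ ℕ-solve 3 (λ x y z → x :+ℕ (y :+ℕ z) :=ℕ y :+ℕ (x :+ℕ z)) refl
         (c ℕ.* w) (lookup α j ℕ.* lookup a j) (weighted (removeAt a j) (removeAt α j)) ⟩
  lookup α j ℕ.* lookup a j + (c ℕ.* w + weighted (removeAt a j) (removeAt α j)) ∎

weighted-pred : (a α : Vec ℕ k) (j : Fin k) {c : ℕ} → lookup α j ≡ suc c →
                weighted a α ≡ weighted a (α [ j ]≔ c) + lookup a j
weighted-pred (w ∷ a) (_ ∷ α) zero {c} refl =
  ℕ-solve 3 (λ c w x → w :+ℕ c :*ℕ w :+ℕ x :=ℕ c :*ℕ w :+ℕ x :+ℕ w) refl c w (weighted a α)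
weighted-pred (w ∷ a) (d ∷ α) (suc j) eq =
  trans (cong (d ℕ.* w +_) (weighted-pred a α j eq)) (sym (ℕ.+-assoc (d ℕ.* w) _ _))

-- Every exponent is a sum of unit vectors, that is, every monomial is a product of variables.
exponent-induction : (P : Exponent k → Set) → P (replicate k 0) →
                     (∀ i γ → P γ → P (unit i ⊕ γ)) → ∀ α → P α
exponent-induction P z s []      = z
exponent-induction P z s (a ∷ α) = go a
  where
  go : ∀ a → P (a ∷ α)
  go zero    = exponent-induction (P ∘ (0 ∷_)) z (λ i γ → s (suc i) (0 ∷ γ)) α
  go (suc a) = subst (P ∘ (suc a ∷_)) (⊕-identityˡ α) (s zero (a ∷ α) (go a))

module Toric (a : Vec ℕ k) where

  degree : Exponent (suc k) → ℕ
  degree (α₀ ∷ α) = α₀ + weighted a α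

  degree-⊕ : ∀ α β → degree (α ⊕ β) ≡ degree α + degree β
  degree-⊕ (α₀ ∷ α) (β₀ ∷ β) = trans (cong (α₀ + β₀ +_) (weighted-⊕ a α β))
    (ℕ-solve 4 (λ x y u v → (x :+ℕ y) :+ℕ (u :+ℕ v) :=ℕ (x :+ℕ u) :+ℕ (y :+ℕ v)) refl
       α₀ β₀ (weighted a α) (weighted a β))

  pure : ℕ → Exponent (suc k)
  pure N = N ∷ replicate k 0

  degree-pure : ∀ N → degree (pure N) ≡ N
  degree-pure N = trans (cong (N +_) (weighted-0 a)) (ℕ.+-identityʳ N)

  -- Membership in the kernel of the substitution yᵢ ↦ x^aᵢ.

  Balanced : Poly (suc k) → Set
  Balanced p = ∀ (φ : ℕ → ℚ) → eval p (φ ∘ degree) ≡ 0ℚ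

  -- Multiplying by a monomial of exponent γ replaces φ by its translate φ ∘ (degree γ +_). This is
  -- why `Balanced` ranges over all φ.
  Balanced-combination : ∀ {r} (h f : Vec (Poly (suc k)) r) → (∀ i → Balanced (lookup f i)) →
                         Balanced (combination h f)
  Balanced-combination []      []      bal φ = refl
  Balanced-combination (t ∷ h) (g ∷ f) bal φ = begin
    eval (t *ᴾ g +ᴾ combination h f) (φ ∘ degree) ≡⟨ eval-+ᴾ (t *ᴾ g) _ _ ⟩
    eval (t *ᴾ g) (φ ∘ degree) ℚ.+ eval (combination h f) (φ ∘ degree)
      ≡⟨ cong₂ ℚ._+_ balanced-* (Balanced-combination h f (bal ∘ suc) φ) ⟩
    0ℚ ∎
    where
    balanced-* : eval (t *ᴾ g) (φ ∘ degree) ≡ 0ℚ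
    balanced-* = begin
      eval (t *ᴾ g) (φ ∘ degree) ≡⟨ eval-*ᴾ t g (φ ∘ degree) ⟩
      eval t (λ γ → eval g (λ δ → φ (degree (γ ⊕ δ))))
        ≡⟨ (eval-cong t λ γ → trans (eval-cong g λ δ → cong φ (degree-⊕ γ δ))
                                    (bal zero (φ ∘ (degree γ +_)))) ⟩
      eval t (λ _ → 0ℚ) ≡⟨ eval-0 t ⟩
      0ℚ ∎

  lookup-generators : ∀ i → lookup (I-generators a) i ≡ y i -ᴾ x^ (lookup a i)
  lookup-generators = Vec.lookup∘tabulate _

  I⇒Balanced : ∀ p → p ∈ I a → Balanced p
  I⇒Balanced p (h , p≈h) φ = trans (≈⇒≋ p (combination h (I-generators a)) p≈h (φ ∘ degree))
                                   (Balanced-combination h (I-generators a) generators φ)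
    where
    generators : ∀ i → Balanced (lookup (I-generators a) i)
    generators i φ = begin
      eval (lookup (I-generators a) i) (φ ∘ degree)
        ≡⟨ cong (flip eval (φ ∘ degree)) (lookup-generators i) ⟩
      eval (y i -ᴾ x^ (lookup a i)) (φ ∘ degree) ≡⟨ eval--ᴾ (y i) (x^ (lookup a i)) (φ ∘ degree) ⟩
      eval (y i) (φ ∘ degree) ℚ.- eval (x^ (lookup a i)) (φ ∘ degree)
        ≡⟨ cong₂ ℚ._-_ (eval-monomial (unit (suc i)) (φ ∘ degree))
                       (eval-monomial (pure (lookup a i)) (φ ∘ degree)) ⟩
      φ (weighted a (unit i)) ℚ.- φ (degree (pure (lookup a i)))
        ≡⟨ cong₂ (λ c d → φ c ℚ.- φ d) (weighted-unit a i) (degree-pure (lookup a i)) ⟩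
      φ (lookup a i) ℚ.- φ (lookup a i) ≡⟨ ℚ.+-inverseʳ (φ (lookup a i)) ⟩
      0ℚ ∎

  infix 4 _~_

  _~_ : Exponent (suc k) → Exponent (suc k) → Set
  α ~ β = monomial α -ᴾ monomial β ∈ I a

  ~-sym : ∀ α β → α ~ β → β ~ α
  ~-sym α β = Ideal-swap (monomial α) (monomial β)

  ~-trans : ∀ α β γ → α ~ β → β ~ γ → α ~ γ
  ~-trans α β γ = Ideal-telescope (monomial α) (monomial β) (monomial γ)

  ~-refl : ∀ α → α ~ α
  ~-refl α = Ideal-resp-≋ [] (monomial α -ᴾ monomial α)
    (λ φ → sym (trans (eval--ᴾ (monomial α) (monomial α) φ) (ℚ.+-inverseʳ (eval (monomial α) φ))))
    Ideal-0

  ⊕-cong-~ : ∀ γ α β → α ~ β → γ ⊕ α ~ γ ⊕ β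
  ⊕-cong-~ γ α β α~β =
    Ideal-resp-≋ (monomial γ *ᴾ (monomial α -ᴾ monomial β)) (monomial (γ ⊕ α) -ᴾ monomial (γ ⊕ β))
      shift (Ideal-* (monomial γ) (monomial α -ᴾ monomial β) α~β)
    where
    shift : monomial γ *ᴾ (monomial α -ᴾ monomial β) ≋ monomial (γ ⊕ α) -ᴾ monomial (γ ⊕ β)
    shift φ = begin
      eval (monomial γ *ᴾ (monomial α -ᴾ monomial β)) φ
        ≡⟨ eval-*ᴾ (monomial γ) (monomial α -ᴾ monomial β) φ ⟩
      eval (monomial γ) (λ δ → eval (monomial α -ᴾ monomial β) (φ ∘ (δ ⊕_)))
        ≡⟨ eval-monomial γ (λ δ → eval (monomial α -ᴾ monomial β) (φ ∘ (δ ⊕_))) ⟩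
      eval (monomial α -ᴾ monomial β) (φ ∘ (γ ⊕_))
        -- Both pairings unfold to the same sum of two terms.
        ≡⟨⟩
      eval (monomial (γ ⊕ α) -ᴾ monomial (γ ⊕ β)) φ ∎

  -- The generators identify each yᵢ with a power of x. As `_~_` is stable under multiplication by
  -- monomials, every monomial reduces to the power of x of its degree, a canonical representative.
  ~-pure : ∀ α → α ~ pure (degree α)
  ~-pure = exponent-induction (λ α → α ~ pure (degree α))
    (subst (λ N → pure 0 ~ pure N) (sym (degree-pure 0)) (~-refl (pure 0))) step
    where
    unit~pure : ∀ i → unit i ~ pure (degree (unit i))
    unit~pure zero    = subst (λ N → pure 1 ~ pure N) (sym (degree-pure 1)) (~-refl (pure 1))
    unit~pure (suc i) = subst (λ N → unit (suc i) ~ pure N) (sym (weighted-unit a i))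
      (subst (_∈ I a) (lookup-generators i) (generator∈Ideal i))

    -- The summands are exchanged to match `degree (unit i) + degree γ`, the order given by
    -- `degree-⊕`.
    pure-⊕ : ∀ M N → pure M ⊕ pure N ≡ pure (N + M)
    pure-⊕ M N = cong₂ _∷_ (ℕ.+-comm M N) (⊕-identityˡ (replicate k 0))

    step : ∀ i γ → γ ~ pure (degree γ) → unit i ⊕ γ ~ pure (degree (unit i ⊕ γ))
    step i γ γ~ =
      ~-trans (unit i ⊕ γ) (unit i ⊕ pure (degree γ)) (pure (degree (unit i ⊕ γ)))
        (⊕-cong-~ (unit i) γ (pure (degree γ)) γ~)
        (subst₂ _~_ (⊕-comm (pure (degree γ)) (unit i))
          (trans (pure-⊕ (degree γ) (degree (unit i))) (cong pure (sym (degree-⊕ (unit i) γ))))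
          (⊕-cong-~ (pure (degree γ)) (unit i) (pure (degree (unit i))) (unit~pure i)))

  degree-≡⇒~ : ∀ α β → degree α ≡ degree β → α ~ β
  degree-≡⇒~ α β eq = ~-trans α (pure (degree α)) β (~-pure α)
    (subst (λ N → pure N ~ β) (sym eq) (~-sym β (pure (degree β)) (~-pure β)))

  -- If γ were alone in its degree, pairing with the indicator of that degree would isolate its
  -- coefficient, which would then be zero. Only this one pairing is assumed to vanish, so that the
  -- lemma also serves normal forms, which need not be balanced in degree N.
  partner : ∀ p {γ} → γ ∈supp p → eval p (λ β → indicator (degree β ℕ.≟ degree γ)) ≡ 0ℚ →
            ∃[ β ] β ∈supp p × degree β ≡ degree γ × β ≢ γ
  partner p {γ} γ∈ balanced
    with any-supp? p (λ β → (degree β ℕ.≟ degree γ) ×-dec ¬? (β ≟ᵉ γ))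
  ... | yes found = found
  ... | no ¬found = contradiction coeff≡0 γ∈
    where
    φ : Exponent (suc k) → ℚ
    φ β = indicator (degree β ℕ.≟ degree γ)

    vanishes : ∀ β → β ≢ γ → coeff p β ℚ.* φ β ≡ 0ℚ
    vanishes β β≢γ with coeff p β ℚ.≟ 0ℚ
    ... | yes p≡0 = trans (cong (ℚ._* φ β) p≡0) (ℚ.*-zeroˡ (φ β))
    ... | no β∈   = trans
      (cong (coeff p β ℚ.*_)
        (indicator-no (degree β ℕ.≟ degree γ) λ eq → ¬found (β , β∈ , eq , β≢γ)))
      (ℚ.*-zeroʳ (coeff p β))

    coeff≡0 : coeff p γ ≡ 0ℚ
    coeff≡0 = begin
      coeff p γ ≡⟨ ℚ.*-identityʳ (coeff p γ) ⟨
      coeff p γ ℚ.* 1ℚ ≡⟨ cong (coeff p γ ℚ.*_) (indicator-yes (degree γ ℕ.≟ degree γ) refl) ⟨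
      coeff p γ ℚ.* φ γ ≡⟨ eval-isolate p γ φ vanishes ⟨
      eval p φ ≡⟨ balanced ⟩
      0ℚ ∎

  -- Standard exponents and normal forms of powers of x

  module _ {ord : MonomialOrdering (suc k)} {G : Vec (Poly (suc k)) r}
           (isReduced : IsReducedGroebnerBasis ord (I a) G) where
    open MonomialOrderingProperties ord
    open GroebnerProperties isReduced
    open IsReducedGroebnerBasis isReduced
    open IsGroebnerBasis isGroebnerBasis

    -- Otherwise the binomial of the two monomials would be an element of the ideal with leading
    -- exponent α.
    standard-minimal : ∀ α β → α ∉ E ord G → degree α ≡ degree β → ¬ (β ≺ α)
    standard-minimal α β α∉E eq β≺α =
      α∉E (covering (monomial α -ᴾ monomial β) (degree-≡⇒~ α β eq) α (IsExp-binomial β≺α))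

    -- The leading exponent γ of a basis element has a partner of the same degree in its support,
    -- smaller by maximality of γ. Adding δ preserves both properties.
    smaller-representative : ∀ {β} → β ∈ E ord G → ∃[ β′ ] degree β′ ≡ degree β × β′ ≺ β
    smaller-representative (i , γ , δ , exp , refl) = multiple
      (partner (lookup G i) (IsExp.inSupport exp)
        (I⇒Balanced (lookup G i) (subset i) (λ d → indicator (d ℕ.≟ degree γ))))
      where
      multiple : ∃[ γ′ ] γ′ ∈supp lookup G i × degree γ′ ≡ degree γ × γ′ ≢ γ →
                 ∃[ β′ ] degree β′ ≡ degree (γ ⊕ δ) × β′ ≺ γ ⊕ δ
      multiple (γ′ , γ′∈ , eq , γ′≢γ) = γ′ ⊕ δ ,
        trans (degree-⊕ γ′ δ) (trans (cong (_+ degree δ) eq) (sym (degree-⊕ γ δ))) ,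
        ⊕-monoˡ δ (≼∧≢⇒≺ (IsExp.maximal exp γ′ γ′∈) γ′≢γ)

    -- Replacing β by smaller exponents of its degree must stop outside `E`. The bound α ≼ β is kept
    -- because it later bounds the quotients of a normal form.
    standard-representative : ∀ {β} → Acc _≺_ β →
                              ∃[ α ] α ∉ E ord G × degree α ≡ degree β × α ≼ β
    standard-representative {β} (acc rec) = descend (E? β)
      where
      descend : Dec (β ∈ E ord G) → ∃[ α ] α ∉ E ord G × degree α ≡ degree β × α ≼ β
      descend (no β∉E)  = β , β∉E , refl , inj₂ refl
      descend (yes β∈E) =
        let β′ , eq , β′≺β     = smaller-representative β∈E
            α , α∉E , eq′ , α≼ = standard-representative (rec β′≺β)
        in α , α∉E , trans eq′ eq , inj₁ (≼-≺-trans α≼ β′≺β)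

    -- Modulo a balanced combination f equals x^N, so the indicator of any degree other than N pairs
    -- to zero with f. An exponent of such a degree would have a partner in f, yet two distinct
    -- standard exponents never share a degree: the larger would not be minimal.
    exp-normalForm-degree : ∀ {N f α} → IsNormalForm ord G (x^ N) f → α ∈supp f →
                            degree α ≡ N
    exp-normalForm-degree {N} {f} {α} nf α∈ =
      sym (decidable-stable (N ℕ.≟ degree α) λ N≢ → ¬partner (partner f α∈ (balanced N≢)))
      where
      open IsNormalForm nf

      φ : ℕ → ℚ
      φ d = indicator (d ℕ.≟ degree α)

      balanced : N ≢ degree α → eval f (φ ∘ degree) ≡ 0ℚ
      balanced N≢ = begin
        eval f (φ ∘ degree) ≡⟨ ℚ.+-identityˡ (eval f (φ ∘ degree)) ⟨
        0ℚ ℚ.+ eval f (φ ∘ degree)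
          ≡⟨ cong (ℚ._+ eval f (φ ∘ degree))
               (Balanced-combination quotients G (λ i → I⇒Balanced (lookup G i) (subset i)) φ) ⟨
        eval (combination quotients G) (φ ∘ degree) ℚ.+ eval f (φ ∘ degree)
          ≡⟨ eval-+ᴾ (combination quotients G) f (φ ∘ degree) ⟨
        eval (combination quotients G +ᴾ f) (φ ∘ degree)
          ≡⟨ ≈⇒≋ (x^ N) (combination quotients G +ᴾ f) division (φ ∘ degree) ⟨
        eval (x^ N) (φ ∘ degree) ≡⟨ eval-monomial (pure N) (φ ∘ degree) ⟩
        φ (degree (pure N)) ≡⟨ cong φ (degree-pure N) ⟩
        φ N ≡⟨ indicator-no (N ℕ.≟ degree α) N≢ ⟩
        0ℚ ∎

      ¬partner : ¬ (∃[ β ] β ∈supp f × degree β ≡ degree α × β ≢ α)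
      ¬partner (β , β∈ , eq , β≢α) with compare β α
      ... | tri< β≺α _ _ = standard-minimal α β (standard α α∈) (sym eq) β≺α
      ... | tri≈ _ β≡α _ = β≢α β≡α
      ... | tri> _ _ α≺β = standard-minimal β α (standard β β∈) eq α≺β

    -- The binomial x^N - m, with m the monomial of α, lies in the ideal and all its exponents are
    -- at most `pure N`; dividing it supplies the quotients and their bound.
    monomial-normalForm : ∀ {N α} → α ∉ E ord G → degree α ≡ N → α ≼ pure N →
                          IsNormalForm ord G (x^ N) (monomial α)
    monomial-normalForm {N} {α} α∉E eq α≼ = record
      { quotients = q
      ; division  = ≋⇒≈ (x^ N) (combination q G +ᴾ monomial α) divided
      ; bounded   = λ i β expβ →
          pure N , IsExp-monomial (pure N) , proj₂ (proj₂ quotient) i β (IsExp.inSupport expβ)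
      ; standard  = λ β β∈ → subst (_∉ E ord G) (sym (∈supp-monomial β∈)) α∉E
      }
      where
      below : ∀ {β} → β ∈supp (x^ N) ⊎ β ∈supp (monomial α) → β ≼ pure N
      below (inj₁ β∈) = inj₂ (∈supp-monomial β∈)
      below (inj₂ β∈) = subst (_≼ pure N) (sym (∈supp-monomial β∈)) α≼

      quotient : Division (x^ N -ᴾ monomial α) (pure N)
      quotient = ideal-division (x^ N -ᴾ monomial α)
        (degree-≡⇒~ (pure N) α (trans (degree-pure N) (sym eq)))
        (λ β β∈ → below (∈supp--ᴾ (x^ N) (monomial α) β∈))

      q : Vec (Poly (suc k)) r
      q = proj₁ quotient

      divided : x^ N ≋ combination q G +ᴾ monomial α
      divided φ = begin
        eval (x^ N) φ
          ≡⟨ solve 2 (λ x y → x := (x :+ :- y) :+ y) refl (eval (x^ N) φ) (eval (monomial α) φ) ⟩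
        (eval (x^ N) φ ℚ.- eval (monomial α) φ) ℚ.+ eval (monomial α) φ
          ≡⟨ cong (ℚ._+ eval (monomial α) φ) (eval--ᴾ (x^ N) (monomial α) φ) ⟨
        eval (x^ N -ᴾ monomial α) φ ℚ.+ eval (monomial α) φ
          ≡⟨ cong (ℚ._+ eval (monomial α) φ)
               (≈⇒≋ (x^ N -ᴾ monomial α) (combination q G) (proj₁ (proj₂ quotient)) φ) ⟩
        eval (combination q G) φ ℚ.+ eval (monomial α) φ
          ≡⟨ eval-+ᴾ (combination q G) (monomial α) φ ⟨
        eval (combination q G +ᴾ monomial α) φ ∎

-- Apéry sets

module AperySet (S : Pred ℕ 0ℓ) {s : ℕ} (s≢0 : s ≢ 0) where

  private
    instance
      s-nonZero : ℕ.NonZero s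
      s-nonZero = ℕ.≢-nonZero s≢0

  mod-shift : ∀ i q → (i + q ℕ.* s) ≡ i [mod s ]
  mod-shift i q = ∣.divides q (trans (ℕ.∣-∣-comm (i + q ℕ.* s) i) (ℕ.∣m-m+n∣≡n i (q ℕ.* s)))

  -- Congruence uses the absolute difference, so the case v < i must be ruled out: s would divide
  -- the positive number i - v, which is less than s.
  mod-witness : ∀ v i → i < s → v ≡ i [mod s ] → ∃[ q ] v ≡ i + q ℕ.* s
  mod-witness v i i<s s∣ with ℕ.≤-total i v
  ... | inj₁ i≤v with ∣.divides q eq ← subst (s ∣.∣_) (ℕ.m≤n⇒∣n-m∣≡n∸m i≤v) s∣ =
    q , trans (sym (ℕ.m+[n∸m]≡n i≤v)) (cong (i +_) eq)
  ... | inj₂ v≤i with i ℕ.∸ v in eq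
  ...   | zero  = 0 , trans (ℕ.≤-antisym v≤i (ℕ.m∸n≡0⇒m≤n eq)) (sym (ℕ.+-identityʳ i))
  ...   | suc d = contradiction
    (ℕ.≤-trans (∣.∣⇒≤ (subst (s ∣.∣_) (trans (ℕ.m≤n⇒∣m-n∣≡n∸m v≤i) eq) s∣))
               (subst (_≤ i) eq (ℕ.m∸n≤m i v)))
    (ℕ.<⇒≱ i<s)

  Ap⇒∈ : 0 ∈ S → ∀ {w} → w ∈ Ap S s → w ∈ S
  Ap⇒∈ 0∈S (inj₁ refl)               = 0∈S
  Ap⇒∈ 0∈S (inj₂ (_ , _ , _ , least)) = IsLeastCongruent.member least

  -- If w = v + s, then v is a smaller element of S in the same residue class; for w = 0 the
  -- equation fails as s is positive.
  Ap⇒≢+s : ∀ {w} → w ∈ Ap S s → ∀ v → v ∈ S → w ≢ v + s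
  Ap⇒≢+s (inj₁ refl) v v∈S eq = s≢0 (ℕ.m+n≡0⇒n≡0 v (sym eq))
  Ap⇒≢+s {w} (inj₂ (i , _ , i<s , isLeast)) v v∈S refl
    with mod-witness (v + s) i i<s (IsLeastCongruent.congruent isLeast)
  -- Quotient zero would give v + s = i < s.
  ... | zero  , eq = ℕ.<⇒≱ i<s (subst (s ≤_) (trans eq (ℕ.+-identityʳ i)) (ℕ.m≤n+m s v))
  ... | suc q , eq = ℕ.<⇒≱ (ℕ.m<m+n v (ℕ.>-nonZero⁻¹ s))
    (IsLeastCongruent.least isLeast v v∈S (subst (_≡ i [mod s ]) (sym v≡) (mod-shift i q)))
    where
    v≡ : v ≡ i + q ℕ.* s
    v≡ = ℕ.+-cancelʳ-≡ s v (i + q ℕ.* s) (trans eq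
      (ℕ-solve 3 (λ i s x → i :+ℕ (s :+ℕ x) :=ℕ i :+ℕ x :+ℕ s) refl i s (q ℕ.* s)))

  -- The class is that of w % s. A smaller element of S in it could be raised by multiples of s up
  -- to w - s, which is excluded. In class 0 the multiples of s themselves lie in S, which leaves
  -- only w = 0.
  ∈∧≢+s⇒Ap : (∀ q {v} → v ∈ S → v + q ℕ.* s ∈ S) → 0 ∈ S →
             ∀ {w} → w ∈ S → (∀ v → v ∈ S → w ≢ v + s) → w ∈ Ap S s
  ∈∧≢+s⇒Ap closed 0∈S {w} w∈S ≢+s with w % s in eqᵢ | m≡m%n+[m/n]*n w s
  ... | zero  | w≡ with w / s
  ...   | zero  = inj₁ w≡
  ...   | suc q = contradiction (trans w≡ (ℕ.+-comm s (q ℕ.* s))) (≢+s (q ℕ.* s) (closed q 0∈S))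
  ∈∧≢+s⇒Ap closed 0∈S {w} w∈S ≢+s | i@(suc _) | w≡ = inj₂ (i , s≤s z≤n , i<s , record
    { member    = w∈S
    ; congruent = subst (_≡ i [mod s ]) (sym w≡) (mod-shift i (w / s))
    ; least     = least
    })
    where
    i<s : i < s
    i<s = subst (_< s) eqᵢ (m%n<n w s)

    least : ∀ v → v ∈ S → v ≡ i [mod s ] → w ≤ v
    least v v∈S v≡i with mod-witness v i i<s v≡i
    ... | q , refl with ℕ.≤-<-connex (w / s) q
    ...   | inj₁ w/s≤q = subst (_≤ i + q ℕ.* s) (sym w≡) (ℕ.+-monoʳ-≤ i (ℕ.*-monoˡ-≤ s w/s≤q))
    -- Here w / s = q + 1 + d: raising v by d multiples of s reaches exactly w - s.
    ...   | inj₂ q<w/s with d , eq ← ℕ.m≤n⇒∃[o]m+o≡n q<w/s =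
      contradiction w≡v+ds+s (≢+s (i + q ℕ.* s + d ℕ.* s) (closed d v∈S))
      where
      w≡v+ds+s : w ≡ i + q ℕ.* s + d ℕ.* s + s
      w≡v+ds+s = trans w≡ (trans (cong (λ c → i + c ℕ.* s) (sym eq))
        (ℕ-solve 4 (λ i q d s → i :+ℕ (ℕ-con 1 :+ℕ (q :+ℕ d)) :*ℕ s :=ℕ
                                 i :+ℕ q :*ℕ s :+ℕ d :*ℕ s :+ℕ s) refl i q d s))

-- The two inclusions between `Δ` and `Ap`

theorem6 : ∀ {m} (a : Vec ℕ (suc m)) → GcdOne a → (∀ i → lookup a i ≢ 0) →
    (j : Fin (suc m)) (≺ⱼ : MonomialOrdering (2 + m)) → IsAperyOrdering a j ≺ⱼ →
    ∀ {r} (B : Vec (Poly (2 + m)) r) → IsReducedGroebnerBasis ≺ⱼ (I a) B →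
    Δ ≺ⱼ j B ≐ Ap ⟨ a ⟩ (lookup a j)
theorem6 a _ a≢0 j ≺ⱼ isApery B isReduced = Δ⊆Ap , Ap⊆Δ
  where
  open Toric a
  open MonomialOrderingProperties ≺ⱼ
  open IsAperyOrdering isApery
  open AperySet ⟨ a ⟩ (a≢0 j)

  s : ℕ
  s = lookup a j

  0∈⟨a⟩ : 0 ∈ ⟨ a ⟩
  0∈⟨a⟩ = replicate _ 0 , sym (weighted-0 a)

  ⟨a⟩-+s : ∀ {v} → v ∈ ⟨ a ⟩ → v + s ∈ ⟨ a ⟩
  ⟨a⟩-+s (l , refl) =
    l ⊕ unit j , sym (trans (weighted-⊕ a l (unit j)) (cong (weighted a l +_) (weighted-unit a j)))

  ⟨a⟩-+qs : ∀ q {v} → v ∈ ⟨ a ⟩ → v + q ℕ.* s ∈ ⟨ a ⟩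
  ⟨a⟩-+qs zero    {v} v∈ = subst ⟨ a ⟩ (sym (ℕ.+-identityʳ v)) v∈
  ⟨a⟩-+qs (suc q) {v} v∈ = subst ⟨ a ⟩ (ℕ.+-assoc v s (q ℕ.* s)) (⟨a⟩-+qs q (⟨a⟩-+s v∈))

  -- The second criterion ignores the weight carried by yⱼ.

  yⱼ-smaller : ∀ α β → weighted a α ≡ weighted a β → lookup α j ≡ 0 → lookup β j ≢ 0 →
               (0 ∷ β) ≺ (0 ∷ α)
  yⱼ-smaller α β eq αⱼ≡0 βⱼ≢0 = Equivalence.from (comparison (0 ∷ β) (0 ∷ α))
    (inj₂ (refl , inj₁ (subst (weight β <_) total (ℕ.m<n+m (weight β) positive))))
    where
    weight : Exponent _ → ℕ
    weight γ = weighted (removeAt a j) (removeAt γ j)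

    positive : 0 < lookup β j ℕ.* s
    positive = ℕ.*-mono-≤ (ℕ.n≢0⇒n>0 βⱼ≢0) (ℕ.n≢0⇒n>0 (a≢0 j))

    total : lookup β j ℕ.* s + weight β ≡ weight α
    total = begin
      lookup β j ℕ.* s + weight β ≡⟨ weighted-removeAt a β j ⟨
      weighted a β                ≡⟨ eq ⟨
      weighted a α                ≡⟨ weighted-removeAt a α j ⟩
      lookup α j ℕ.* s + weight α ≡⟨ cong (λ c → c ℕ.* s + weight α) αⱼ≡0 ⟩
      weight α                    ∎

  Δ⊆Ap : ∀ {N} → N ∈ Δ ≺ⱼ j B → N ∈ Ap ⟨ a ⟩ s
  Δ⊆Ap {N} (f , (.0 ∷ α) , nf , exp , refl , αⱼ≡0 , α∉E) =
    ∈∧≢+s⇒Ap ⟨a⟩-+qs 0∈⟨a⟩ (α , sym degree≡N) irreducible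
    where
    degree≡N : weighted a α ≡ N
    degree≡N = exp-normalForm-degree isReduced nf (IsExp.inSupport exp)

    irreducible : ∀ v → v ∈ ⟨ a ⟩ → N ≢ v + s
    irreducible v (l , refl) N≡ =
      -- A factorization l of N - a_j, multiplied by yⱼ, has degree N and undercuts α.
      standard-minimal isReduced (0 ∷ α) (0 ∷ l ⊕ unit j) α∉E eq
        (yⱼ-smaller α (l ⊕ unit j) eq αⱼ≡0 nonzero)
      where
      eq : weighted a α ≡ weighted a (l ⊕ unit j)
      eq = begin
        weighted a α                        ≡⟨ trans degree≡N N≡ ⟩
        weighted a l + s                    ≡⟨ cong (weighted a l +_) (weighted-unit a j) ⟨
        weighted a l + weighted a (unit j)  ≡⟨ weighted-⊕ a l (unit j) ⟨
        weighted a (l ⊕ unit j)             ∎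

      nonzero : lookup (l ⊕ unit j) j ≢ 0
      nonzero lⱼ+1≡0 = ℕ.1+n≢0 (trans (sym (ℕ.+-comm (lookup l j) 1)) (begin
        lookup l j + 1                ≡⟨ cong (lookup l j +_) (Vec.lookup∘update j (replicate _ 0) 1) ⟨
        lookup l j + lookup (unit j) j ≡⟨ Vec.lookup-zipWith _+_ j l (unit j) ⟨
        lookup (l ⊕ unit j) j         ≡⟨ lⱼ+1≡0 ⟩
        0                             ∎))

  Ap⊆Δ : ∀ {N} → N ∈ Ap ⟨ a ⟩ s → N ∈ Δ ≺ⱼ j B
  -- The descent starts at x^N itself, so its result is bounded by `pure N`.
  Ap⊆Δ {N} N∈Ap = standard (standard-representative isReduced (wellFounded (pure N)))
    where
    standard : ∃[ α ] α ∉ E ≺ⱼ B × degree α ≡ degree (pure N) × α ≼ pure N → N ∈ Δ ≺ⱼ j B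
    standard (α₀ ∷ α , α∉E , eq , α≼) = monomial (α₀ ∷ α) , (α₀ ∷ α) ,
      monomial-normalForm isReduced α∉E degree≡N α≼ , IsExp-monomial (α₀ ∷ α) , α₀≡0 , αⱼ≡0 , α∉E
      where
      degree≡N : α₀ + weighted a α ≡ N
      degree≡N = trans eq (degree-pure N)

      α₀≡0 : α₀ ≡ 0
      α₀≡0 = decidable-stable (α₀ ℕ.≟ 0) λ α₀≢0 →
        -- A factorization of N in the monoid is an exponent of the same degree free of x, hence
        -- smaller by the first criterion.
        let l , N≡ = Ap⇒∈ 0∈⟨a⟩ N∈Ap in
        standard-minimal isReduced (α₀ ∷ α) (0 ∷ l) α∉E (trans degree≡N N≡)
          (Equivalence.from (comparison (0 ∷ l) (α₀ ∷ α)) (inj₁ (ℕ.n≢0⇒n>0 α₀≢0)))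

      αⱼ≡0 : lookup α j ≡ 0
      αⱼ≡0 with lookup α j in αⱼ≡
      ... | zero  = refl
      -- Removing one factor yⱼ from α would factor N - a_j in the monoid.
      ... | suc c = contradiction
        (trans (sym degree≡N) (trans (cong (_+ weighted a α) α₀≡0) (weighted-pred a α j αⱼ≡)))
        (Ap⇒≢+s N∈Ap (weighted a (α [ j ]≔ c)) (α [ j ]≔ c , refl))
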